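{- Let $\mathbf{1}$ be the tuple of all $1$'s, and let $$\Delta_{k,(1^{(n-2)},2),\mathbf{1}}=\Big\{x\in\mathbb{R}^n_{\ge 0} : \sum_{i=1}^n x_i=k,\ x_i\le 1 \text{ for } 1\le i\le n-2,\ x_{n-1}+x_n\le 1\Big\}$$ (the base polytope of the panhandle matroid $\mathrm{Pan}_{k,n-2,n}$). Let $0\le m\le n-1$ if $1\le k\le n-2$, and $0\le m\le 2$ if $k=n-1$. Then the coefficient of $t^m$ in $(n-1)!\,\mathrm{ehr}(\Delta_{k,(1^{(n-2)},2),\mathbf{1}},t)$ is positive.
   Context: For a polytope $P\subset\mathbb{R}^n$ with integral vertices, $\mathrm{ehr}(P,t)$ is the (Ehrhart) polynomial in $t$ with $\mathrm{ehr}(P,t)=\#(tP\cap\mathbb{Z}^n)$ for all positive integers $t$. The symbol $1^{(n-2)}$ denotes $n-2$ copies of $1$, and the tuple $\mathbf{1}$ records that all upper bounds in the definition of the polytope are equal to $1$.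
   Formalization: For k = n−1 the formal range is 0 ≤ m ≤ 1 instead of 0 ≤ m ≤ 2, since the polytope is then a unit segment with Ehrhart polynomial t+1, whose t² coefficient is 0, so the claim fails for m = 2. -}

module Defs where

open import Data.Nat as ℕ using (ℕ; zero; suc)
open import Data.Integer as ℤ using (ℤ; +_)
open import Data.Rational using (ℚ; 0ℚ; 1ℚ; _/_; _+_; _*_; _≤_)
open import Data.Fin using (Fin; toℕ)
open import Data.List using (List; []; _∷_; length)
import Data.List as List
open import Data.List.Membership.Propositional using (_∈_)
open import Data.List.Relation.Unary.Unique.Propositional using (Unique)
open import Data.Vec using (Vec; lookup; foldr′)
import Data.Vec as Vec
open import Data.Product using (∃-syntax; _×_)
open import Function using (_⇔_)
open import Level using (0ℓ)
open import Relation.Binary.PropositionalEquality using (_≡_)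
open import Relation.Unary using (Pred)

ℤ→ℚ : ℤ → ℚ
ℤ→ℚ z = z / 1

ℕ→ℚ : ℕ → ℚ
ℕ→ℚ n = ℤ→ℚ (+ n)

-- A polytope is represented by its set of rational points.  Nothing is lost
-- for lattice-point counting: for t ≥ 1 an integer point of tP is t times a
-- rational point of P.
PointSet : ℕ → Set₁
PointSet n = Pred (Vec ℚ n) 0ℓ

dilate : ∀ {n} → ℕ → PointSet n → PointSet n
dilate t P y = ∃[ x ] P x × y ≡ Vec.map (ℕ→ℚ t *_) x

latticePoints : ∀ {n} → PointSet n → Pred (Vec ℤ n) 0ℓ
latticePoints P z = P (Vec.map ℤ→ℚ z)

HasCardinality : {A : Set} → Pred A 0ℓ → ℕ → Set
HasCardinality S c =
  ∃[ xs ] Unique xs × (∀ a → a ∈ xs ⇔ S a) × length xs ≡ c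

-- Univariate polynomials over ℚ: coefficient lists, constant term first;
-- trailing zeros are allowed.
Poly : Set
Poly = List ℚ

coeff : Poly → ℕ → ℚ
coeff []      m       = 0ℚ
coeff (a ∷ p) zero    = a
coeff (a ∷ p) (suc m) = coeff p m

eval : Poly → ℚ → ℚ
eval []      x = 0ℚ
eval (a ∷ p) x = a + x * eval p x

infixr 7 _·_

_·_ : ℚ → Poly → Poly
c · p = List.map (c *_) p

-- The values at all positive integers determine the coefficients, so at most
-- one polynomial (up to trailing zeros) satisfies this.
IsEhrhartPolynomial : ∀ {n} → PointSet n → Poly → Set
IsEhrhartPolynomial P p =
  ∀ t → 1 ℕ.≤ t →
  ∃[ c ] HasCardinality (latticePoints (dilate t P)) c × eval p (ℕ→ℚ t) ≡ ℕ→ℚ c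

-- Δ n k is Δ_{k,(1^{(n-2)},2),𝟏}, for n ≥ 2.  Coordinates are x₁, …, xₙ, so
-- i : Fin n stands for the index 1 + toℕ i.
--
-- For k = n - 1 every upper bound is forced to be an equality, so Δ n k is the
-- segment {(1, …, 1, a, 1 - a) : 0 ≤ a ≤ 1}, with Ehrhart polynomial t + 1:
-- only the coefficients of t⁰ and t¹ are positive in that case.
record Δ (n k : ℕ) (x : Vec ℚ n) : Set where
  field
    nonneg    : ∀ i → 0ℚ ≤ lookup x i
    total     : foldr′ _+_ 0ℚ x ≡ ℕ→ℚ k
    ≤1        : ∀ i → suc (toℕ i) ℕ.≤ n ℕ.∸ 2 → lookup x i ≤ 1ℚ
    lastTwo≤1 : ∀ i j → suc (toℕ i) ≡ n ℕ.∸ 1 → suc (toℕ j) ≡ n →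
                lookup x i + lookup x j ≤ 1ℚ

{-# OPTIONS --safe #-}

-- Put d = n - 2.  By symmetry of the coordinates, weighting each point of the
-- dilated hypersimplex t Δ_{k,n-1} by x_{n-1} + 1 (the number of ways to split the
-- last coordinate in two) multiplies the count by the average 1 + k t / (n - 1), so
--   ehr(Δ_{k,(1^{(n-2)},2),𝟏}, t) = (1 + k t / (n - 1)) ehr(Δ_{k,n-1}, t)
-- and it suffices that the coefficients of the hypersimplex polynomial are positive.
-- For this, the count is the coefficient of q^(k t) in ((1 - q^(t+1)) / (1 - q))^(d+1),
-- that is ∑_j [z^j q^τ] ((1 - z q) / (1 - q))^(d+1) with τ = (k - j) t.  The symmetry
-- of the Delannoy-type array δ rewrites this, up to the factor τ / (d + 1), as
-- [x^(d+1)] ((1 - z x) / (1 - x))^τ, which is a polynomial in τ (1 - z) and z with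
-- nonnegative coefficients.  The powers of 1 - z turn ∑ kᵐ zᵏ into Eulerian polynomials,
-- which are positive as well.
module Submission where

open import Data.Nat as ℕ using (ℕ; zero; suc; _≤_; _∸_; _!; z≤n; s≤s)
import Data.Nat.Properties as ℕ
open import Data.Integer as ℤ using (ℤ; +_; -[1+_]; 0ℤ; 1ℤ; _+_; _*_; _-_; -_)
import Data.Integer.Properties as ℤ
open import Data.Integer.Tactic.RingSolver using (solve-∀)
open import Data.Rational as ℚ using (ℚ; 0ℚ; 1ℚ; _<_)
import Data.Rational.Properties as ℚ
import Data.Rational.Solver as ℚ
open import Data.Rational.Unnormalised as ℚᵘ using (mkℚᵘ; *≡*; *≤*)
import Data.Rational.Unnormalised.Properties as ℚᵘ
open import Data.Fin using (Fin; zero; suc; toℕ)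
open import Data.List using (List; []; _∷_; length; map; _++_; applyUpTo)
import Data.List.Properties as List
open import Data.List.Membership.Propositional using (_∈_)
open import Data.List.Membership.Propositional.Properties
  using (∈-map⁺; ∈-map⁻; ∈-++⁺ˡ; ∈-++⁺ʳ; ∈-++⁻)
open import Data.List.Relation.Unary.Any using (here)
open import Data.List.Relation.Unary.All using ([])
open import Data.List.Relation.Unary.AllPairs using ([]; _∷_)
open import Data.List.Relation.Unary.Unique.Propositional using (Unique)
import Data.List.Relation.Unary.Unique.Propositional.Properties as Unique
open import Data.List.Relation.Binary.Disjoint.Propositional using (Disjoint)
open import Data.Vec as Vec using (Vec; []; _∷_; lookup; foldr′)
import Data.Vec.Properties as Vec
open import Data.Product using (∃-syntax; _×_; _,_)
open import Data.Sum using (_⊎_; inj₁; inj₂)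
open import Function using (_∘_; id; _⇔_; mk⇔)
open import Relation.Nullary using (yes; no; contradiction)
open import Relation.Binary.PropositionalEquality
  using (_≡_; refl; sym; trans; cong; cong₂; subst; subst₂; _≗_; module ≡-Reasoning)
open import Defs
open ≡-Reasoning

-- Formal power series

Series : Set
Series = ℕ → ℤ

one : Series
one zero    = 1ℤ
one (suc _) = 0ℤ

-- Multiplication by the variable, so that `D` is multiplication by 1 - z and `θ` is the Euler
-- operator z d/dz. The same operators act on series in q when the index is τ or a.
Z : Series → Series
Z u zero    = 0ℤ
Z u (suc j) = u j

D : Series → Series
D u j = u j - Z u j

θ : Series → Series
θ u k = + k * u k

Z-cong : ∀ {u v} → u ≗ v → Z u ≗ Z v
Z-cong e zero    = refl
Z-cong e (suc j) = e j

D-cong : ∀ {u v} → u ≗ v → D u ≗ D v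
D-cong e j = cong₂ _-_ (e j) (Z-cong e j)

Z-lin : ∀ a b u v → Z (λ j → a * u j + b * v j) ≗ λ j → a * Z u j + b * Z v j
Z-lin a b u v zero    = lemma a b
  where
  lemma : ∀ a b → 0ℤ ≡ a * 0ℤ + b * 0ℤ
  lemma = solve-∀
Z-lin a b u v (suc j) = refl

Z-+ : ∀ u v → Z (λ j → u j + v j) ≗ λ j → Z u j + Z v j
Z-+ u v zero    = refl
Z-+ u v (suc j) = refl

Z-scale : ∀ a u → Z (λ j → a * u j) ≗ λ j → a * Z u j
Z-scale a u zero    = sym (ℤ.*-zeroʳ a)
Z-scale a u (suc j) = refl

D-Z : ∀ u → D (Z u) ≗ Z (D u)
D-Z u zero    = refl
D-Z u (suc j) = refl

D-lin : ∀ a b u v → D (λ j → a * u j + b * v j) ≗ λ j → a * D u j + b * D v j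
D-lin a b u v j = trans (cong (λ z → a * u j + b * v j - z) (Z-lin a b u v j))
                        (lemma a b (u j) (v j) (Z u j) (Z v j))
  where
  lemma : ∀ a b x y x′ y′ →
          a * x + b * y - (a * x′ + b * y′) ≡ a * (x - x′) + b * (y - y′)
  lemma = solve-∀

-- Brings differences into the shape that the `-lin` lemmas expect.
difference-lin : ∀ x y → x - y ≡ 1ℤ * x + - 1ℤ * y
difference-lin = solve-∀

D-scale : ∀ a u → D (λ j → a * u j) ≗ λ j → a * D u j
D-scale a u j = trans (cong (λ z → a * u j - z) (Z-scale a u j)) (lemma a (u j) (Z u j))
  where
  lemma : ∀ a x y → a * x - a * y ≡ a * (x - y)
  lemma = solve-∀

-- Partial sums undo multiplication by 1 - z, so each coefficient is recovered from the one before
-- it.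
D-injective : ∀ {u v} → D u ≗ D v → u ≗ v
D-injective {u} {v} e zero = begin
  u 0       ≡⟨ lemma (u 0) ⟩
  D u 0     ≡⟨ e 0 ⟩
  D v 0     ≡⟨ lemma (v 0) ⟨
  v 0       ∎
  where
  lemma : ∀ x → x ≡ x - 0ℤ
  lemma = solve-∀
D-injective {u} {v} e (suc j) = begin
  u (suc j)                ≡⟨ lemma (u (suc j)) (u j) ⟩
  D u (suc j) + u j        ≡⟨ cong₂ _+_ (e (suc j)) (D-injective {u} {v} e j) ⟩
  D v (suc j) + v j        ≡⟨ lemma (v (suc j)) (v j) ⟨
  v (suc j)                ∎
  where
  lemma : ∀ x y → x ≡ x - y + y
  lemma = solve-∀

-- A Delannoy-type array

-- ∑ δ d τ pᵈ q^τ = 1 / (1 - p - q + z p q), so that ∑_d δ d τ pᵈ = (1 - z p)^τ / (1 - p)^(τ+1).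
δ : ℕ → ℕ → Series
δ zero    τ       = one
δ (suc d) zero    = one
δ (suc d) (suc τ) = λ j → δ (suc d) τ j + δ d (suc τ) j - Z (δ d τ) j

δ-0 : ∀ d → δ d 0 ≡ one
δ-0 zero    = refl
δ-0 (suc d) = refl

-- Both sides have the generating function (1 - z) / (1 - p - q + z p q)², which is symmetric in p
-- and q. The proof is an induction along the recurrence of `δ`.
δ-balance : ∀ d τ j → + suc d * (δ (suc d) τ j - Z (δ d τ) j)
                    ≡ + suc τ * (δ d (suc τ) j - Z (δ d τ) j)
δ-balance zero zero j = refl
δ-balance zero (suc τ) j =
  trans (lemma₁ (+ suc τ) (δ 1 τ j) (one j) (Z one j))
        (trans (cong (_+ (one j - Z one j)) (δ-balance zero τ j))
               (lemma₂ (+ suc τ) (one j) (Z one j)))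
  where
  lemma₁ : ∀ T x y z → 1ℤ * ((x + y - z) - z) ≡ 1ℤ * (x - z) + (y - z)
  lemma₁ = solve-∀
  lemma₂ : ∀ T y z → T * (y - z) + (y - z) ≡ (1ℤ + T) * (y - z)
  lemma₂ = solve-∀
δ-balance (suc d) zero j rewrite δ-0 d =
  trans (lemma₁ (+ suc d) (one j) (Z one j))
        (trans (cong (_+ (one j - Z one j)) (base d))
               (lemma₂ (δ d 1 j) (one j) (Z one j)))
  where
  base : ∀ d → + suc d * (one j - Z one j) ≡ 1ℤ * (δ d 1 j - Z one j)
  base d with δ-balance d zero j
  ... | e rewrite δ-0 d = e
  lemma₁ : ∀ A y z → (1ℤ + A) * (y - z) ≡ A * (y - z) + (y - z)
  lemma₁ = solve-∀
  lemma₂ : ∀ x y z → 1ℤ * (x - z) + (y - z) ≡ 1ℤ * ((y + x - z) - z)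
  lemma₂ = solve-∀
δ-balance (suc d) (suc τ) j =
  step (+ suc d) (+ suc τ) (δ (suc (suc d)) τ j) (δ (suc d) (suc τ) j) (δ d (suc (suc τ)) j)
    (Z (δ (suc d) τ) j) (Z (δ d (suc τ)) j) (Z (δ (suc d) (suc τ)) j)
    (δ-balance (suc d) τ j) (δ-balance d (suc τ) j) (under-Z j)
  where
  A T : ℤ
  A = + suc d
  T = + suc τ
  -- Below `Z` the entry at (d + 1, τ + 1) unfolds by the recurrence, which reduces the claim to the
  -- balance at (d, τ).
  under-Z : ∀ j → A * (Z (δ (suc d) (suc τ)) j - Z (δ d (suc τ)) j)
                ≡ T * (Z (δ (suc d) (suc τ)) j - Z (δ (suc d) τ) j)
  under-Z zero    = trans (ℤ.*-zeroʳ A) (sym (ℤ.*-zeroʳ T))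
  under-Z (suc j) = begin
    A * (x + y - z - y) ≡⟨ lemma₁ A x y z ⟩
    A * (x - z)         ≡⟨ δ-balance d τ j ⟩
    T * (y - z)         ≡⟨ lemma₂ T x y z ⟩
    T * (x + y - z - x) ∎
    where
    x = δ (suc d) τ j
    y = δ d (suc τ) j
    z = Z (δ d τ) j
    lemma₁ : ∀ A x y z → A * (x + y - z - y) ≡ A * (x - z)
    lemma₁ = solve-∀
    lemma₂ : ∀ T x y z → T * (y - z) ≡ T * (x + y - z - x)
    lemma₂ = solve-∀
  -- The two digits are the offsets from d and τ. An x stands for a value of `δ`, a z for a value of
  -- `Z` applied to `δ`.
  step : ∀ A T x20 x11 x02 z10 z01 z11 →
         (1ℤ + A) * (x20 - z10) ≡ T * (x11 - z10) →
         A * (x11 - z01) ≡ (1ℤ + T) * (x02 - z01) →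
         A * (z11 - z01) ≡ T * (z11 - z10) →
         (1ℤ + A) * (x20 + x11 - z10 - z11) ≡ (1ℤ + T) * (x11 + x02 - z01 - z11)
  step A T x20 x11 x02 z10 z01 z11 e₁ e₂ e₃ = begin
    (1ℤ + A) * (x20 + x11 - z10 - z11)
      ≡⟨ l₁ A x20 x11 z10 z11 ⟩
    (1ℤ + A) * (x20 - z10) + (1ℤ + A) * (x11 - z11)
      ≡⟨ cong (_+ (1ℤ + A) * (x11 - z11)) e₁ ⟩
    T * (x11 - z10) + (1ℤ + A) * (x11 - z11)
      ≡⟨ l₂ A T x11 z10 z11 ⟩
    T * (z11 - z10) + ((1ℤ + A) * (x11 - z11) + T * (x11 - z11))
      ≡⟨ cong (_+ ((1ℤ + A) * (x11 - z11) + T * (x11 - z11))) e₃ ⟨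
    A * (z11 - z01) + ((1ℤ + A) * (x11 - z11) + T * (x11 - z11))
      ≡⟨ l₃ A T x11 z01 z11 ⟩
    A * (x11 - z01) + (1ℤ + T) * (x11 - z11)
      ≡⟨ cong (_+ (1ℤ + T) * (x11 - z11)) e₂ ⟩
    (1ℤ + T) * (x02 - z01) + (1ℤ + T) * (x11 - z11)
      ≡⟨ l₄ T x11 x02 z01 z11 ⟩
    (1ℤ + T) * (x11 + x02 - z01 - z11) ∎
    where
    l₁ : ∀ A x20 x11 z10 z11 → (1ℤ + A) * (x20 + x11 - z10 - z11)
         ≡ (1ℤ + A) * (x20 - z10) + (1ℤ + A) * (x11 - z11)
    l₁ = solve-∀
    l₂ : ∀ A T x11 z10 z11 → T * (x11 - z10) + (1ℤ + A) * (x11 - z11)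
         ≡ T * (z11 - z10) + ((1ℤ + A) * (x11 - z11) + T * (x11 - z11))
    l₂ = solve-∀
    l₃ : ∀ A T x11 z01 z11 → A * (z11 - z01) + ((1ℤ + A) * (x11 - z11) + T * (x11 - z11))
         ≡ A * (x11 - z01) + (1ℤ + T) * (x11 - z11)
    l₃ = solve-∀
    l₄ : ∀ T x11 x02 z01 z11 → (1ℤ + T) * (x02 - z01) + (1ℤ + T) * (x11 - z11)
         ≡ (1ℤ + T) * (x11 + x02 - z01 - z11)
    l₄ = solve-∀

-- The coefficient of pᵈ in (1 - z p)^(τ-1) / (1 - p)^(τ+1): the recursion divides the series of `δ`
-- by 1 - z p.
η : ℕ → ℕ → Series
η zero    τ = one
η (suc d) τ = λ j → Z (η d τ) j + δ (suc d) τ j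

-- In generating functions this is (1 - z p) - z (1 - p) = 1 - z.
D-η : ∀ d τ → D (η d (suc τ)) ≗ λ j → δ d (suc τ) j - Z (δ d τ) j
D-η zero    τ j = refl
D-η (suc d) τ zero = lemma (δ (suc d) (suc τ) 0)
  where
  lemma : ∀ x → 0ℤ + x - 0ℤ ≡ x - 0ℤ
  lemma = solve-∀
D-η (suc d) τ (suc j) = begin
  (η d (suc τ) j + δ (suc d) (suc τ) (suc j)) - (Z (η d (suc τ)) j + δ (suc d) (suc τ) j)
    ≡⟨ l₁ (η d (suc τ) j) (δ (suc d) (suc τ) (suc j)) (Z (η d (suc τ)) j) (δ (suc d) (suc τ) j) ⟩
  D (η d (suc τ)) j + (δ (suc d) (suc τ) (suc j) - δ (suc d) (suc τ) j)
    ≡⟨ cong (_+ (δ (suc d) (suc τ) (suc j) - δ (suc d) (suc τ) j)) (D-η d τ j) ⟩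
  (δ d (suc τ) j - Z (δ d τ) j) + (δ (suc d) (suc τ) (suc j) - δ (suc d) (suc τ) j)
    ≡⟨ l₂ (δ d (suc τ) j) (Z (δ d τ) j) (δ (suc d) (suc τ) (suc j)) (δ (suc d) τ j) ⟩
  δ (suc d) (suc τ) (suc j) - δ (suc d) τ j ∎
  where
  l₁ : ∀ a b c d → (a + b) - (c + d) ≡ (a - c) + (b - d)
  l₁ = solve-∀
  l₂ : ∀ a b c d → (a - b) + (c - (d + a - b)) ≡ c - d
  l₂ = solve-∀

-- The differential equation F′ = τ (1 - z) F / ((1 - p) (1 - z p)) of F = ((1 - z p) / (1 - p))^τ,
-- read off at pᵈ. The coefficients of F are the differences of those of `δ`.
δ-step : ∀ d τ j → + suc d * (δ (suc d) τ j - δ d τ j) ≡ + τ * D (η d τ) j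
δ-step d zero j rewrite δ-0 d = lemma (+ suc d) (one j) (D (η d 0) j)
  where
  lemma : ∀ A x y → A * (x - x) ≡ 0ℤ * y
  lemma = solve-∀
δ-step d (suc τ) j = begin
  + suc d * (δ (suc d) (suc τ) j - δ d (suc τ) j)
    ≡⟨ lemma (+ suc d) (δ (suc d) τ j) (δ d (suc τ) j) (Z (δ d τ) j) ⟩
  + suc d * (δ (suc d) τ j - Z (δ d τ) j)
    ≡⟨ δ-balance d τ j ⟩
  + suc τ * (δ d (suc τ) j - Z (δ d τ) j)
    ≡⟨ cong (+ suc τ *_) (D-η d τ j) ⟨
  + suc τ * D (η d (suc τ)) j ∎
  where
  lemma : ∀ A x y z → A * (x + y - z - y) ≡ A * (x - z)
  lemma = solve-∀

-- Weighted Lah numbers and Eulerian numbers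

-- ev τ M w = ∑_{m ≤ M} τᵐ Dᵐ (w m), i.e. the substitution s = (1 - z) τ in ∑ₘ w m sᵐ.
ev : ℤ → ℕ → (ℕ → Series) → Series
ev τ zero    w = w 0
ev τ (suc M) w = λ j → w 0 j + τ * ev τ M (λ m → D (w (suc m))) j

ev-cong : ∀ τ M {v w} → (∀ m → v m ≗ w m) → ev τ M v ≗ ev τ M w
ev-cong τ zero    e j = e 0 j
ev-cong τ (suc M) e j =
  cong₂ (λ x y → x + τ * y) (e 0 j) (ev-cong τ M (λ m → D-cong (e (suc m))) j)

ev-lin : ∀ τ M a b v w → ev τ M (λ m j → a * v m j + b * w m j)
                       ≗ λ j → a * ev τ M v j + b * ev τ M w j
ev-lin τ zero    a b v w j = refl
ev-lin τ (suc M) a b v w j = begin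
  a * v 0 j + b * w 0 j + τ * ev τ M (λ m → D (λ i → a * v (suc m) i + b * w (suc m) i)) j
    ≡⟨ cong (λ x → a * v 0 j + b * w 0 j + τ * x)
         (trans (ev-cong τ M (λ m → D-lin a b (v (suc m)) (w (suc m))) j)
                (ev-lin τ M a b (λ m → D (v (suc m))) (λ m → D (w (suc m))) j)) ⟩
  a * v 0 j + b * w 0 j + τ * (a * v′ + b * w′)
    ≡⟨ lemma τ a b (v 0 j) v′ (w 0 j) w′ ⟩
  a * (v 0 j + τ * v′) + b * (w 0 j + τ * w′) ∎
  where
  v′ = ev τ M (λ m → D (v (suc m))) j
  w′ = ev τ M (λ m → D (w (suc m))) j
  lemma : ∀ τ a b x x′ y y′ → a * x + b * y + τ * (a * x′ + b * y′)
                            ≡ a * (x + τ * x′) + b * (y + τ * y′)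
  lemma = solve-∀

ev-Z : ∀ τ M w → ev τ M (λ m → Z (w m)) ≗ Z (ev τ M w)
ev-Z τ zero    w j = refl
ev-Z τ (suc M) w j =
  trans (cong (λ x → Z (w 0) j + τ * x)
          (trans (ev-cong τ M (λ m → D-Z (w (suc m))) j) (ev-Z τ M (λ m → D (w (suc m))) j)))
        (final j)
  where
  final : ∀ j → Z (w 0) j + τ * Z (ev τ M (λ m → D (w (suc m)))) j
              ≡ Z (ev τ (suc M) w) j
  final zero    = trans (ℤ.+-identityˡ (τ * 0ℤ)) (ℤ.*-zeroʳ τ)
  final (suc j) = refl

ev-D : ∀ τ M w → ev τ M (λ m → D (w m)) ≗ D (ev τ M w)
ev-D τ M w j = begin
  ev τ M (λ m → D (w m)) j
    ≡⟨ ev-cong τ M (λ m i → difference-lin (w m i) (Z (w m) i)) j ⟩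
  ev τ M (λ m i → 1ℤ * w m i + - 1ℤ * Z (w m) i) j
    ≡⟨ ev-lin τ M 1ℤ (- 1ℤ) w (λ m → Z (w m)) j ⟩
  1ℤ * ev τ M w j + - 1ℤ * ev τ M (λ m → Z (w m)) j
    ≡⟨ cong (λ x → 1ℤ * ev τ M w j + - 1ℤ * x) (ev-Z τ M w j) ⟩
  1ℤ * ev τ M w j + - 1ℤ * Z (ev τ M w) j
    ≡⟨ difference-lin (ev τ M w j) (Z (ev τ M w) j) ⟨
  D (ev τ M w) j ∎

ev-0 : ∀ τ M → ev τ M (λ _ _ → 0ℤ) ≗ λ _ → 0ℤ
ev-0 τ zero    j = refl
ev-0 τ (suc M) j = trans (cong (λ x → 0ℤ + τ * x) (trans (ev-cong τ M (λ _ → D-0) j) (ev-0 τ M j)))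
                         (lemma τ)
  where
  D-0 : D (λ _ → 0ℤ) ≗ λ _ → 0ℤ
  D-0 zero    = refl
  D-0 (suc j) = refl
  lemma : ∀ τ → 0ℤ + τ * 0ℤ ≡ 0ℤ
  lemma = solve-∀

shift : (ℕ → ℕ) → ℕ → ℕ
shift u zero    = 0
shift u (suc j) = u j

-- With F = ((1 - z x) / (1 - x))^(s / (1 - z)), the numbers f d m j, g d m j and
-- h d m j are the coefficients of xᵈ/d! · sᵐ · zʲ in F, F / (1 - x) and
-- F / ((1 - x) (1 - z x)); the recursion for f is the differential equation
-- F′ = s F / ((1 - x) (1 - z x)).  The f d m j are the weighted Lah numbers.
f g h : ℕ → ℕ → ℕ → ℕ
f zero    zero    zero    = 1
f zero    zero    (suc _) = 0
f zero    (suc _) _       = 0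
f (suc d) zero    _       = 0
f (suc d) (suc m) j       = h d m j
g zero    m j = f zero m j
g (suc d) m j = suc d ℕ.* g d m j ℕ.+ f (suc d) m j
h zero    m j = g zero m j
h (suc d) m j = suc d ℕ.* shift (h d m) j ℕ.+ g (suc d) m j

infix 8 +∘_

+∘_ : {A : Set} → (A → ℕ) → A → ℤ
(+∘ u) a = + u a

shift-Z : ∀ u → +∘ shift u ≗ Z (+∘ u)
shift-Z u zero    = refl
shift-Z u (suc j) = refl

g⁺ h⁺ : ℕ → ℕ → Series
g⁺ d m = +∘ g d m
h⁺ d m = +∘ h d m

g-suc : ∀ d m j → g⁺ (suc d) m j ≡ + suc d * g⁺ d m j + 1ℤ * + f (suc d) m j
g-suc d m j = cong₂ _+_ (ℤ.pos-* (suc d) (g d m j)) (sym (ℤ.*-identityˡ (+ f (suc d) m j)))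

h-suc : ∀ d m j → h⁺ (suc d) m j ≡ + suc d * Z (h⁺ d m) j + 1ℤ * g⁺ (suc d) m j
h-suc d m j = cong₂ _+_ (trans (ℤ.pos-* (suc d) (shift (h d m) j))
                               (cong (+ suc d *_) (shift-Z (h d m) j)))
                        (sym (ℤ.*-identityˡ (g⁺ (suc d) m j)))

ev-f₀ : ∀ τ M → ev τ M (λ m → +∘ f 0 m) ≗ one
ev-f₀ τ zero    zero    = refl
ev-f₀ τ zero    (suc j) = refl
ev-f₀ τ (suc M) j = begin
  + f 0 0 j + τ * ev τ M (λ m → D (+∘ f 0 (suc m))) j
    ≡⟨ cong₂ (λ x y → x + τ * y) (f₀ j) (trans (ev-cong τ M (λ m → D-0 m) j) (ev-0 τ M j)) ⟩
  one j + τ * 0ℤ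
    ≡⟨ lemma τ (one j) ⟩
  one j ∎
  where
  f₀ : +∘ f 0 0 ≗ one
  f₀ zero    = refl
  f₀ (suc j) = refl
  D-0 : ∀ m → D (+∘ f 0 (suc m)) ≗ λ _ → 0ℤ
  D-0 m zero    = refl
  D-0 m (suc j) = refl
  lemma : ∀ τ x → x + τ * 0ℤ ≡ x
  lemma = solve-∀

-- The substitution s = (1 - z) τ turns the series F of the weighted Lah numbers into ((1 - z x) /
-- (1 - x))^τ, and `δ-step` is the matching form of its differential equation. No power of s above d
-- occurs, so any M ≥ d gives the same value.
ev-g : ∀ d τ {M} → d ≤ M → ev (+ τ) M (g⁺ d) ≗ λ j → + (d !) * δ d τ j
ev-h : ∀ d τ {M} → d ≤ M → ev (+ τ) M (h⁺ d) ≗ λ j → + (d !) * η d τ j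

ev-g zero    τ {M} _ j = trans (ev-f₀ (+ τ) M j) (sym (ℤ.*-identityˡ (one j)))
ev-g (suc d) τ {suc M} (s≤s d≤M) j = begin
  ev (+ τ) (suc M) (g⁺ (suc d)) j
    ≡⟨ trans (ev-cong (+ τ) (suc M) (g-suc d) j)
             (ev-lin (+ τ) (suc M) (+ suc d) 1ℤ (g⁺ d) (λ m → +∘ f (suc d) m) j) ⟩
  -- `f (suc d)` is `h d` moved up by one power of s, so one factor τ (1 - z) comes out.
  + suc d * ev (+ τ) (suc M) (g⁺ d) j + 1ℤ * (0ℤ + + τ * ev (+ τ) M (λ m → D (h⁺ d m)) j)
    ≡⟨ cong₂ (λ x y → + suc d * x + 1ℤ * (0ℤ + + τ * y))
         (ev-g d τ (ℕ.m≤n⇒m≤1+n d≤M) j)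
         (trans (ev-D (+ τ) M (h⁺ d) j)
                (trans (D-cong (ev-h d τ d≤M) j) (D-scale (+ (d !)) (η d τ) j))) ⟩
  + suc d * (+ (d !) * δ d τ j) + 1ℤ * (0ℤ + + τ * (+ (d !) * D (η d τ) j))
    ≡⟨ l₁ (+ suc d) (+ (d !)) (δ d τ j) (+ τ) (D (η d τ) j) ⟩
  + (d !) * (+ suc d * δ d τ j + + τ * D (η d τ) j)
    ≡⟨ cong (λ x → + (d !) * (+ suc d * δ d τ j + x)) (δ-step d τ j) ⟨
  + (d !) * (+ suc d * δ d τ j + + suc d * (δ (suc d) τ j - δ d τ j))
    ≡⟨ l₂ (+ suc d) (+ (d !)) (δ d τ j) (δ (suc d) τ j) ⟩
  + suc d * + (d !) * δ (suc d) τ j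
    ≡⟨ cong (_* δ (suc d) τ j) (ℤ.pos-* (suc d) (d !)) ⟨
  + (suc d !) * δ (suc d) τ j ∎
  where
  l₁ : ∀ A B x T y → A * (B * x) + 1ℤ * (0ℤ + T * (B * y)) ≡ B * (A * x + T * y)
  l₁ = solve-∀
  l₂ : ∀ A B x y → B * (A * x + A * (y - x)) ≡ A * B * y
  l₂ = solve-∀

ev-h zero    τ M≥ j = ev-g zero τ M≥ j
ev-h (suc d) τ {suc M} d<M@(s≤s d≤M) j = begin
  ev (+ τ) (suc M) (h⁺ (suc d)) j
    ≡⟨ trans (ev-cong (+ τ) (suc M) (h-suc d) j)
             (ev-lin (+ τ) (suc M) (+ suc d) 1ℤ (λ m → Z (h⁺ d m)) (g⁺ (suc d)) j) ⟩
  + suc d * ev (+ τ) (suc M) (λ m → Z (h⁺ d m)) j + 1ℤ * ev (+ τ) (suc M) (g⁺ (suc d)) j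
    ≡⟨ cong₂ (λ x y → + suc d * x + 1ℤ * y)
         (trans (ev-Z (+ τ) (suc M) (h⁺ d) j)
                (trans (Z-cong (ev-h d τ (ℕ.m≤n⇒m≤1+n d≤M)) j) (Z-scale (+ (d !)) (η d τ) j)))
         (ev-g (suc d) τ d<M j) ⟩
  + suc d * (+ (d !) * Z (η d τ) j) + 1ℤ * (+ (suc d !) * δ (suc d) τ j)
    ≡⟨ cong (λ x → + suc d * (+ (d !) * Z (η d τ) j) + 1ℤ * (x * δ (suc d) τ j)) (ℤ.pos-* (suc d) (d !)) ⟩
  + suc d * (+ (d !) * Z (η d τ) j) + 1ℤ * (+ suc d * + (d !) * δ (suc d) τ j)
    ≡⟨ lemma (+ suc d) (+ (d !)) (Z (η d τ) j) (δ (suc d) τ j) ⟩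
  + suc d * + (d !) * (Z (η d τ) j + δ (suc d) τ j)
    ≡⟨ cong (_* η (suc d) τ j) (ℤ.pos-* (suc d) (d !)) ⟨
  + (suc d !) * η (suc d) τ j ∎
  where
  lemma : ∀ A B x y → A * (B * x) + 1ℤ * (A * B * y) ≡ A * B * (x + y)
  lemma = solve-∀

-- All summands are natural numbers, so one positive summand suffices. A power of s comes from `f`,
-- a power of z from the shifted term of `h`, and each costs one unit of d.
g-pos : ∀ d m → m ≤ d → 0 ℕ.< g d m 0
h-pos   : ∀ d m j → m ℕ.+ j ≤ d → 0 ℕ.< h d m j

g-pos zero    zero    _ = s≤s z≤n
g-pos (suc d) zero    _ =
  ℕ.≤-trans (g-pos d 0 z≤n) (ℕ.≤-trans (ℕ.m≤n*m (g d 0 0) (suc d)) (ℕ.m≤m+n _ 0))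
g-pos (suc d) (suc m) (s≤s m≤d) =
  ℕ.≤-trans (h-pos d m 0 (ℕ.≤-trans (ℕ.≤-reflexive (ℕ.+-identityʳ m)) m≤d))
    (ℕ.m≤n+m _ (suc d ℕ.* g d (suc m) 0))

h-pos zero    zero zero _ = s≤s z≤n
h-pos (suc d) m zero    m≤d =
  ℕ.≤-trans (g-pos (suc d) m (ℕ.≤-trans (ℕ.m≤m+n m 0) m≤d)) (ℕ.m≤n+m _ (suc d ℕ.* 0))
h-pos (suc d) m (suc j) m≤d =
  ℕ.≤-trans (h-pos d m j (ℕ.≤-pred (ℕ.≤-trans (ℕ.≤-reflexive (sym (ℕ.+-suc m j))) m≤d)))
    (ℕ.≤-trans (ℕ.m≤n*m (h d m j) (suc d)) (ℕ.m≤m+n _ (g (suc d) m (suc j))))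

-- eul m is the coefficient sequence of (1 - z)^(m+1) ∑_{k ≥ 1} kᵐ zᵏ, so that
-- eul m (suc k) is the Eulerian number A(m, k).
eul : ℕ → ℕ → ℕ
eul zero    zero          = 0
eul zero    (suc zero)    = 1
eul zero    (suc (suc _)) = 0
eul (suc m) k = k ℕ.* eul m k ℕ.+ (suc (suc m) ∸ k) ℕ.* shift (eul m) k

-- The degree bound that makes the truncated subtraction in `eul` harmless.
eul-vanish : ∀ m k → suc m ℕ.< k → eul m k ≡ 0
eul-vanish zero    (suc zero)    (s≤s ())
eul-vanish zero    (suc (suc k)) _ = refl
eul-vanish (suc m) (suc k) (s≤s m<k)
  rewrite eul-vanish m k m<k | eul-vanish m (suc k) (ℕ.m≤n⇒m≤1+n m<k)
        | ℕ.*-zeroʳ k | ℕ.*-zeroʳ (suc m ∸ k) = refl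

eul-pos₁ : ∀ m → 0 ℕ.< eul m 1
eul-pos₁ zero    = s≤s z≤n
eul-pos₁ (suc m) = ℕ.≤-trans (eul-pos₁ m) (ℕ.≤-trans (ℕ.m≤m+n (eul m 1) 0) (ℕ.m≤m+n (1 ℕ.* eul m 1) _))

eul-pos : ∀ m k → suc k ≤ m → 0 ℕ.< eul m (suc k)
eul-pos (suc m) zero    _ = eul-pos₁ (suc m)
eul-pos (suc m) (suc k) (s≤s k<m) =
  ℕ.≤-trans (ℕ.*-mono-≤ (ℕ.m<n⇒0<n∸m {k} {m} k<m) (eul-pos m k k<m))
    (ℕ.m≤n+m _ (suc (suc k) ℕ.* eul m (suc (suc k))))

_^[_] : (Series → Series) → ℕ → Series → Series
(L ^[ zero ])  u = u
(L ^[ suc n ]) u = L ((L ^[ n ]) u)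

^-inner : ∀ L n u → (L ^[ n ]) (L u) ≡ L ((L ^[ n ]) u)
^-inner L zero    u = refl
^-inner L (suc n) u = cong L (^-inner L n u)

-- Leibniz rule for the product (1 - z) u, with θ (1 - z) = - z.
D-θ : ∀ u k → D (θ u) k ≡ θ (D u) k + Z u k
D-θ u zero    = refl
D-θ u (suc k) = lemma (+ k) (u (suc k)) (u k)
  where
  lemma : ∀ K x y → (1ℤ + K) * x - K * y ≡ (1ℤ + K) * (x - y) + y
  lemma = solve-∀

D^-θ : ∀ n u k → (D ^[ suc n ]) (θ u) k ≡ θ ((D ^[ suc n ]) u) k + + suc n * Z ((D ^[ n ]) u) k
D^-θ zero    u k = trans (D-θ u k) (cong (λ x → θ (D u) k + x) (sym (ℤ.*-identityˡ (Z u k))))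
D^-θ (suc n) u k = begin
  D ((D ^[ suc n ]) (θ u)) k
    ≡⟨ D-cong (λ i → trans (D^-θ n u i) (lemma₁ (θ (D V) i) (+ suc n * Z V i))) k ⟩
  D (λ i → 1ℤ * θ (D V) i + + suc n * Z V i) k
    ≡⟨ D-lin 1ℤ (+ suc n) (θ (D V)) (Z V) k ⟩
  1ℤ * D (θ (D V)) k + + suc n * D (Z V) k
    ≡⟨ cong₂ (λ x y → 1ℤ * x + + suc n * y) (D-θ (D V) k) (D-Z V k) ⟩
  1ℤ * (θ (D (D V)) k + Z (D V) k) + + suc n * Z (D V) k
    ≡⟨ lemma (+ suc n) (θ (D (D V)) k) (Z (D V) k) ⟩
  θ (D (D V)) k + + suc (suc n) * Z (D V) k ∎
  where
  V = (D ^[ n ]) u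
  lemma₁ : ∀ x y → x + y ≡ 1ℤ * x + y
  lemma₁ = solve-∀
  lemma : ∀ A x y → 1ℤ * (x + y) + A * y ≡ x + (1ℤ + A) * y
  lemma = solve-∀

-- The series z / (1 - z). It has no constant term because the expansion of `β` in `box-expansion`
-- holds for positive τ only.
positive : Series
positive zero    = 0ℤ
positive (suc _) = 1ℤ

-- The recursion regrouped as θ ((1 - z) E) + (m + 2) z E, the form in which `D^-θ` delivers it.
eul-suc : ∀ m k → + eul (suc m) k
                ≡ + k * (+ eul m k - Z (+∘ eul m) k) + + suc (suc m) * Z (+∘ eul m) k
eul-suc m zero    =
  trans (cong +_ (ℕ.*-zeroʳ m)) (sym (trans (ℤ.+-identityˡ _) (ℤ.*-zeroʳ (+ suc (suc m)))))
eul-suc m (suc k) = begin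
  + (suc k ℕ.* eul m (suc k) ℕ.+ (suc m ∸ k) ℕ.* eul m k)
    ≡⟨ cong₂ _+_ (ℤ.pos-* (suc k) (eul m (suc k))) (ℤ.pos-* (suc m ∸ k) (eul m k)) ⟩
  + suc k * + eul m (suc k) + + (suc m ∸ k) * + eul m k
    ≡⟨ cong (λ x → + suc k * + eul m (suc k) + x) monus ⟩
  + suc k * + eul m (suc k) + (+ suc m - + k) * + eul m k
    ≡⟨ lemma (+ suc m) (+ k) (+ eul m (suc k)) (+ eul m k) ⟩
  + suc k * (+ eul m (suc k) - + eul m k) + + suc (suc m) * + eul m k ∎
  where
  -- Beyond k = m + 1 the subtraction is truncated, but there the other factor is zero.
  monus : + (suc m ∸ k) * + eul m k ≡ (+ suc m - + k) * + eul m k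
  monus with ℕ.≤-<-connex k (suc m)
  ... | inj₁ k≤ = cong (_* + eul m k) (trans (sym (ℤ.⊖-≥ k≤)) (sym (ℤ.m-n≡m⊖n (suc m) k)))
  ... | inj₂ k> rewrite eul-vanish m k k> =
    trans (ℤ.*-zeroʳ (+ (suc m ∸ k))) (sym (ℤ.*-zeroʳ (+ suc m - + k)))
  lemma : ∀ M K x y → (1ℤ + K) * x + (M - K) * y ≡ (1ℤ + K) * (x - y) + (1ℤ + M) * y
  lemma = solve-∀

D^-θ^ : ∀ m → (D ^[ suc m ]) ((θ ^[ m ]) positive) ≗ +∘ eul m
D^-θ^ zero zero          = refl
D^-θ^ zero (suc zero)    = refl
D^-θ^ zero (suc (suc k)) = refl
D^-θ^ (suc m) k = begin
  (D ^[ suc (suc m) ]) (θ V) k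
    ≡⟨ D^-θ (suc m) V k ⟩
  θ (D ((D ^[ suc m ]) V)) k + + suc (suc m) * Z ((D ^[ suc m ]) V) k
    ≡⟨ cong₂ (λ x y → + k * x + + suc (suc m) * y) (D-cong (D^-θ^ m) k) (Z-cong (D^-θ^ m) k) ⟩
  + k * D (+∘ eul m) k + + suc (suc m) * Z (+∘ eul m) k
    ≡⟨ eul-suc m k ⟨
  + eul (suc m) k ∎
  where
  V = (θ ^[ m ]) positive

-- Box counts

-- Y r is multiplication by 1 + q + ⋯ + qʳ.
Y : ℕ → Series → Series
Y zero    u = u
Y (suc r) u = λ a → u a + Z (Y r u) a

Y-cong : ∀ r {u v} → u ≗ v → Y r u ≗ Y r v
Y-cong zero    e = e
Y-cong (suc r) e a = cong₂ _+_ (e a) (Z-cong (Y-cong r e) a)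

Y-+ : ∀ r u v → Y r (λ a → u a + v a) ≗ λ a → Y r u a + Y r v a
Y-+ zero    u v a = refl
Y-+ (suc r) u v a =
  trans (cong (λ ξ → u a + v a + ξ) (trans (Z-cong (Y-+ r u v) a) (Z-+ (Y r u) (Y r v) a)))
        (lemma (u a) (v a) (Z (Y r u) a) (Z (Y r v) a))
  where
  lemma : ∀ x y x′ y′ → x + y + (x′ + y′) ≡ x + x′ + (y + y′)
  lemma = solve-∀

Y-scale : ∀ r c u → Y r (λ a → c * u a) ≗ λ a → c * Y r u a
Y-scale zero    c u a = refl
Y-scale (suc r) c u a =
  trans (cong (λ ξ → c * u a + ξ) (trans (Z-cong (Y-scale r c u) a) (Z-scale c (Y r u) a)))
        (sym (ℤ.*-distribˡ-+ c (u a) (Z (Y r u) a)))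

Y-Z : ∀ r u → Y r (Z u) ≗ Z (Y r u)
Y-Z zero    u a       = refl
Y-Z (suc r) u zero    = refl
Y-Z (suc r) u (suc a) = cong (λ x → u a + x) (Y-Z r u a)

Y-comm : ∀ r s u → Y r (Y s u) ≗ Y s (Y r u)
Y-comm r zero    u a = refl
Y-comm r (suc s) u a = begin
  Y r (λ b → u b + Z (Y s u) b) a   ≡⟨ Y-+ r u (Z (Y s u)) a ⟩
  Y r u a + Y r (Z (Y s u)) a       ≡⟨ cong (λ ξ → Y r u a + ξ) (Y-Z r (Y s u) a) ⟩
  Y r u a + Z (Y r (Y s u)) a       ≡⟨ cong (λ ξ → Y r u a + ξ) (Z-cong (Y-comm r s u) a) ⟩
  Y r u a + Z (Y s (Y r u)) a       ∎

-- Y′ r is multiplication by q · d/dq (1 + q + ⋯ + qʳ) = ∑ s qˢ.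
Y′ : ℕ → Series → Series
Y′ zero    u = λ _ → 0ℤ
Y′ (suc r) u = Z (λ a → Y r u a + Y′ r u a)

Y-Y′-comm : ∀ r s u → Y r (Y′ s u) ≗ Y′ s (Y r u)
Y-Y′-comm r zero    u a = vanish r a
  where
  vanish : ∀ r → Y r (λ _ → 0ℤ) ≗ λ _ → 0ℤ
  vanish zero    a       = refl
  vanish (suc r) zero    = refl
  vanish (suc r) (suc a) = trans (ℤ.+-identityˡ _) (vanish r a)
Y-Y′-comm r (suc s) u a = trans (Y-Z r (λ b → Y s u b + Y′ s u b) a) (Z-cong under a)
  where
  under : Y r (λ b → Y s u b + Y′ s u b) ≗ λ b → Y s (Y r u) b + Y′ s (Y r u) b
  under b = trans (Y-+ r (Y s u) (Y′ s u) b) (cong₂ _+_ (Y-comm r s u b) (Y-Y′-comm r s u b))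

-- Leibniz rule: `Y′ r` multiplies by θ of the polynomial by which `Y r` multiplies.
θ-Y : ∀ r u → θ (Y r u) ≗ λ a → Y′ r u a + Y r (θ u) a
θ-Y zero    u a    = sym (ℤ.+-identityˡ (θ u a))
θ-Y (suc r) u zero = refl
θ-Y (suc r) u (suc a) = begin
  (1ℤ + + a) * (u (suc a) + Y r u a)
    ≡⟨ l₁ (+ a) (u (suc a)) (Y r u a) ⟩
  (1ℤ + + a) * u (suc a) + Y r u a + θ (Y r u) a
    ≡⟨ cong (λ x → (1ℤ + + a) * u (suc a) + Y r u a + x) (θ-Y r u a) ⟩
  (1ℤ + + a) * u (suc a) + Y r u a + (Y′ r u a + Y r (θ u) a)
    ≡⟨ l₂ ((1ℤ + + a) * u (suc a)) (Y r u a) (Y′ r u a) (Y r (θ u) a) ⟩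
  (Y r u a + Y′ r u a) + ((1ℤ + + a) * u (suc a) + Y r (θ u) a) ∎
  where
  l₁ : ∀ A x y → (1ℤ + A) * (x + y) ≡ (1ℤ + A) * x + y + A * y
  l₁ = solve-∀
  l₂ : ∀ x y z w → x + y + (z + w) ≡ (y + z) + (x + w)
  l₂ = solve-∀

-- box t d a counts the x ∈ {0, …, t}ᵈ with ∑ xᵢ = a.
box : ℕ → ℕ → Series
box t zero    = one
box t (suc d) = Y t (box t d)

-- Power rule for θ on (1 + q + ⋯ + qᵗ)^(d+1).
θ-box : ∀ t d → θ (box t (suc d)) ≗ λ a → + suc d * Y′ t (box t d) a
θ-box t zero a =
  trans (θ-Y t one a)
        (trans (cong (λ ξ → Y′ t one a + ξ) (trans (Y-cong t θ-one a) (Y-scale t 0ℤ one a)))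
               (lemma (Y′ t one a) (Y t one a)))
  where
  θ-one : θ one ≗ λ a → 0ℤ * one a
  θ-one zero    = refl
  θ-one (suc a) = ℤ.*-zeroʳ (+ suc a)
  lemma : ∀ x y → x + 0ℤ * y ≡ 1ℤ * x
  lemma = solve-∀
θ-box t (suc d) a = begin
  θ (Y t (box t (suc d))) a
    ≡⟨ θ-Y t (box t (suc d)) a ⟩
  Y′ t (box t (suc d)) a + Y t (θ (box t (suc d))) a
    ≡⟨ cong (λ ξ → Y′ t (box t (suc d)) a + ξ)
         (trans (Y-cong t (θ-box t d) a) (Y-scale t (+ suc d) (Y′ t (box t d)) a)) ⟩
  Y′ t (box t (suc d)) a + + suc d * Y t (Y′ t (box t d)) a
    ≡⟨ cong (λ x → Y′ t (box t (suc d)) a + + suc d * x) (Y-Y′-comm t t (box t d) a) ⟩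
  Y′ t (box t (suc d)) a + + suc d * Y′ t (box t (suc d)) a
    ≡⟨ lemma (+ suc d) (Y′ t (box t (suc d)) a) ⟩
  + suc (suc d) * Y′ t (box t (suc d)) a ∎
  where
  lemma : ∀ A x → x + A * x ≡ (1ℤ + A) * x
  lemma = solve-∀

-- panhandle t d a counts the x ∈ {0, …, t}^(d+1) with ∑ xᵢ = a, each weighted by
-- the number x_{d+1} + 1 of ways to split its last coordinate into two.
panhandle : ℕ → ℕ → Series
panhandle t zero    = λ a → θ (box t 1) a + box t 1 a
panhandle t (suc d) = Y t (panhandle t d)

-- The weighted coordinate contributes ∑ (s + 1) qˢ, the sum of the multipliers of `Y′ t` and `Y t`.
-- The other coordinates commute past it.
panhandle-Y′ : ∀ t d → panhandle t d ≗ λ a → Y′ t (box t d) a + box t (suc d) a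
panhandle-Y′ t zero    a =
  cong (_+ box t 1 a) (trans (θ-box t 0 a) (ℤ.*-identityˡ (Y′ t one a)))
panhandle-Y′ t (suc d) a = begin
  Y t (panhandle t d) a
    ≡⟨ Y-cong t (panhandle-Y′ t d) a ⟩
  Y t (λ b → Y′ t (box t d) b + box t (suc d) b) a
    ≡⟨ Y-+ t (Y′ t (box t d)) (box t (suc d)) a ⟩
  Y t (Y′ t (box t d)) a + box t (suc (suc d)) a
    ≡⟨ cong (_+ box t (suc (suc d)) a) (Y-Y′-comm t t (box t d) a) ⟩
  Y′ t (box t (suc d)) a + box t (suc (suc d)) a ∎

-- By symmetry the average of x_{d+1} over the points counted by box t (suc d) a is a / (d + 1).
panhandle-box : ∀ t d a → + suc d * panhandle t d a ≡ (+ suc d + + a) * box t (suc d) a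
panhandle-box t d a = begin
  + suc d * panhandle t d a
    ≡⟨ cong (+ suc d *_) (panhandle-Y′ t d a) ⟩
  + suc d * (Y′ t (box t d) a + box t (suc d) a)
    ≡⟨ ℤ.*-distribˡ-+ (+ suc d) (Y′ t (box t d) a) (box t (suc d) a) ⟩
  + suc d * Y′ t (box t d) a + + suc d * box t (suc d) a
    ≡⟨ cong (_+ + suc d * box t (suc d) a) (θ-box t d a) ⟨
  + a * box t (suc d) a + + suc d * box t (suc d) a
    ≡⟨ lemma (+ a) (+ suc d) (box t (suc d) a) ⟩
  (+ suc d + + a) * box t (suc d) a ∎
  where
  lemma : ∀ a b x → a * x + b * x ≡ (b + a) * x
  lemma = solve-∀

-- The substitution z = qᵗ

Z^-cong : ∀ n {u v} → u ≗ v → (Z ^[ n ]) u ≗ (Z ^[ n ]) v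
Z^-cong zero    e = e
Z^-cong (suc n) e = Z-cong (Z^-cong n e)

Z^-D : ∀ n u → D ((Z ^[ n ]) u) ≗ (Z ^[ n ]) (D u)
Z^-D zero    u a = refl
Z^-D (suc n) u a = trans (D-Z ((Z ^[ n ]) u) a) (Z-cong (Z^-D n u) a)

Z^-lin : ∀ n a b u v → (Z ^[ n ]) (λ j → a * u j + b * v j)
                     ≗ λ j → a * (Z ^[ n ]) u j + b * (Z ^[ n ]) v j
Z^-lin zero    a b u v j = refl
Z^-lin (suc n) a b u v j =
  trans (Z-cong (Z^-lin n a b u v) j) (Z-lin a b ((Z ^[ n ]) u) ((Z ^[ n ]) v) j)

Z^-shift : ∀ n u a → (Z ^[ n ]) u (n ℕ.+ a) ≡ u a
Z^-shift zero    u a = refl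
Z^-shift (suc n) u a = Z^-shift n u a

D-Y : ∀ r u → D (Y r u) ≗ λ a → u a - (Z ^[ suc r ]) u a
D-Y zero    u a       = refl
D-Y (suc r) u zero    = cong (_- 0ℤ) (ℤ.+-identityʳ (u 0))
D-Y (suc r) u (suc a) = begin
  u (suc a) + Y r u a - (u a + Z (Y r u) a) ≡⟨ l₁ (u (suc a)) (Y r u a) (u a) (Z (Y r u) a) ⟩
  u (suc a) - u a + D (Y r u) a             ≡⟨ cong (λ ξ → u (suc a) - u a + ξ) (D-Y r u a) ⟩
  u (suc a) - u a + (u a - Zu)              ≡⟨ l₂ (u (suc a)) (u a) Zu ⟩
  u (suc a) - Zu                            ∎
  where
  Zu = (Z ^[ suc r ]) u a
  l₁ : ∀ x y z w → x + y - (z + w) ≡ x - z + (y - w)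
  l₁ = solve-∀
  l₂ : ∀ x y z → x - y + (y - z) ≡ x - z
  l₂ = solve-∀

-- tsum t J b = ∑_{j ≤ J} q^(j t) ∑_τ b τ j q^τ
tsum : ℕ → ℕ → (ℕ → Series) → Series
tsum t zero    b a = b a 0
tsum t (suc J) b a = b a 0 + (Z ^[ t ]) (tsum t J (λ τ j → b τ (suc j))) a

tsum-cong : ∀ t J {b b′} → (∀ τ → b τ ≗ b′ τ) → tsum t J b ≗ tsum t J b′
tsum-cong t zero    e a = e a 0
tsum-cong t (suc J) e a = cong₂ _+_ (e a 0) (Z^-cong t (tsum-cong t J (λ τ j → e τ (suc j))) a)

tsum-lin : ∀ t J x y b b′ → tsum t J (λ τ j → x * b τ j + y * b′ τ j)
                          ≗ λ a → x * tsum t J b a + y * tsum t J b′ a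
tsum-lin t zero    x y b b′ a = refl
tsum-lin t (suc J) x y b b′ a =
  trans (cong (λ ξ → x * b a 0 + y * b′ a 0 + ξ)
          (trans (Z^-cong t (tsum-lin t J x y (λ τ j → b τ (suc j)) (λ τ j → b′ τ (suc j))) a)
                 (Z^-lin t x y _ _ a)))
        (lemma x y (b a 0) (b′ a 0) _ _)
  where
  lemma : ∀ x y p q p′ q′ → x * p + y * q + (x * p′ + y * q′) ≡ x * (p + p′) + y * (q + q′)
  lemma = solve-∀

tsum-Z : ∀ t J b → tsum t J (λ τ j → Z (λ σ → b σ j) τ) ≗ Z (tsum t J b)
tsum-Z t zero    b zero    = refl
tsum-Z t zero    b (suc a) = refl
tsum-Z t (suc J) b a = trans
  (cong (λ ξ → Z (λ σ → b σ 0) a + ξ)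
    (trans (Z^-cong t (tsum-Z t J (λ τ j → b τ (suc j))) a)
           (cong (λ x → x a) (^-inner Z t (tsum t J (λ τ j → b τ (suc j)))))))
  (sym (Z-+ (λ σ → b σ 0) ((Z ^[ t ]) (tsum t J (λ τ j → b τ (suc j)))) a))

tsum-D : ∀ t J b → tsum t J (λ τ j → D (λ σ → b σ j) τ) ≗ D (tsum t J b)
tsum-D t J b a = begin
  tsum t J (λ τ j → D (λ σ → b σ j) τ) a
    ≡⟨ tsum-cong t J (λ τ j → difference-lin (b τ j) (Z (λ σ → b σ j) τ)) a ⟩
  tsum t J (λ τ j → 1ℤ * b τ j + - 1ℤ * Z (λ σ → b σ j) τ) a
    ≡⟨ tsum-lin t J 1ℤ (- 1ℤ) b (λ τ j → Z (λ σ → b σ j) τ) a ⟩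
  1ℤ * tsum t J b a + - 1ℤ * tsum t J (λ τ j → Z (λ σ → b σ j) τ) a
    ≡⟨ cong (λ x → 1ℤ * tsum t J b a + - 1ℤ * x) (tsum-Z t J b a) ⟩
  1ℤ * tsum t J b a + - 1ℤ * Z (tsum t J b) a
    ≡⟨ difference-lin (tsum t J b a) (Z (tsum t J b) a) ⟨
  D (tsum t J b) a ∎

-- β d τ is the coefficient of q^τ in ((1 - z q) / (1 - q))ᵈ.
β : ℕ → ℕ → Series
β d τ j = D (λ σ → δ d σ j) τ

-- As a series in q, `δ d` is (1 - z q)ᵈ / (1 - q)^(d+1), so one more factor 1 - z q gives
-- `β (suc d)`. The outer `Z` is the factor q, the inner one the factor z.
β-suc : ∀ d τ j → β (suc d) τ j ≡ δ d τ j - Z (λ σ → Z (δ d σ) j) τ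
β-suc d zero    j = cong (λ u → u j - 0ℤ) (sym (δ-0 d))
β-suc d (suc τ) j = lemma (δ (suc d) τ j) (δ d (suc τ) j) (Z (δ d τ) j)
  where
  lemma : ∀ x y z → x + y - z - x ≡ y - z
  lemma = solve-∀

D-β : ∀ d τ j → D (λ σ → β (suc d) σ j) τ ≡ β d τ j - Z (λ σ → Z (β d σ) j) τ
D-β d τ j = begin
  D (λ σ → β (suc d) σ j) τ
    ≡⟨ D-cong (λ σ → trans (β-suc d σ j) (difference-lin (δ d σ j) (Z (λ ρ → Z (δ d ρ) j) σ))) τ ⟩
  D (λ σ → 1ℤ * δ d σ j + - 1ℤ * Z (λ ρ → Z (δ d ρ) j) σ) τ
    ≡⟨ D-lin 1ℤ (- 1ℤ) (λ σ → δ d σ j) (Z (λ ρ → Z (δ d ρ) j)) τ ⟩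
  1ℤ * β d τ j + - 1ℤ * D (Z (λ ρ → Z (δ d ρ) j)) τ
    ≡⟨ cong (λ x → 1ℤ * β d τ j + - 1ℤ * x)
         (trans (D-Z (λ ρ → Z (δ d ρ) j) τ) (Z-cong (under j) τ)) ⟩
  1ℤ * β d τ j + - 1ℤ * Z (λ σ → Z (β d σ) j) τ
    ≡⟨ difference-lin (β d τ j) (Z (λ σ → Z (β d σ) j) τ) ⟨
  β d τ j - Z (λ σ → Z (β d σ) j) τ ∎
  where
  under : ∀ j → D (λ ρ → Z (δ d ρ) j) ≗ λ σ → Z (β d σ) j
  under zero    zero    = refl
  under zero    (suc σ) = refl
  under (suc j) σ       = refl

-- Substituting z = qᵗ in ((1 - z q) / (1 - q))ᵈ gives (1 + q + ⋯ + qᵗ)ᵈ.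
tsum-β : ∀ t d {J} → d ≤ J → tsum t J (β d) ≗ box t d
tsum-β t zero {J} _ a = trans (tsum-D t J (δ 0) a) (trans (D-cong (tsum-one J) a) (D-ones a))
  where
  ones : Series
  ones _ = 1ℤ
  tsum-0 : ∀ J → tsum t J (λ _ _ → 0ℤ) ≗ λ _ → 0ℤ
  tsum-0 J a = trans (tsum-lin t J 0ℤ 0ℤ (λ _ _ → 0ℤ) (λ _ _ → 0ℤ) a)
                     (lemma (tsum t J (λ _ _ → 0ℤ) a))
    where
    lemma : ∀ x → 0ℤ * x + 0ℤ * x ≡ 0ℤ
    lemma = solve-∀
  Z^-0 : ∀ n → (Z ^[ n ]) (λ _ → 0ℤ) ≗ λ _ → 0ℤ
  Z^-0 zero    a       = refl
  Z^-0 (suc n) zero    = refl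
  Z^-0 (suc n) (suc a) = Z^-0 n a
  tsum-one : ∀ J → tsum t J (δ 0) ≗ ones
  tsum-one zero    a = refl
  tsum-one (suc J) a = cong (λ ξ → 1ℤ + ξ) (trans (Z^-cong t (tsum-0 J) a) (Z^-0 t a))
  D-ones : D ones ≗ one
  D-ones zero    = refl
  D-ones (suc a) = refl
tsum-β t (suc d) {suc J} (s≤s d≤J) = D-injective λ a → begin
  D (tsum t (suc J) (β (suc d))) a
    ≡⟨ tsum-D t (suc J) (β (suc d)) a ⟨
  tsum t (suc J) (λ τ j → D (λ σ → β (suc d) σ j) τ) a
    ≡⟨ tsum-cong t (suc J) (λ τ j →
         trans (D-β d τ j) (difference-lin (β d τ j) (Z (λ σ → Z (β d σ) j) τ))) a ⟩
  tsum t (suc J) (λ τ j → 1ℤ * β d τ j + - 1ℤ * Z (λ σ → Z (β d σ) j) τ) a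
    ≡⟨ tsum-lin t (suc J) 1ℤ (- 1ℤ) (β d) (λ τ j → Z (λ σ → Z (β d σ) j) τ) a ⟩
  1ℤ * tsum t (suc J) (β d) a + - 1ℤ * tsum t (suc J) (λ τ j → Z (λ σ → Z (β d σ) j) τ) a
    ≡⟨ cong₂ (λ x y → 1ℤ * x + - 1ℤ * y) (tsum-β t d (ℕ.m≤n⇒m≤1+n d≤J) a)
         (trans (tsum-Z t (suc J) (λ σ → Z (β d σ)) a) (Z-cong under a)) ⟩
  1ℤ * box t d a + - 1ℤ * (Z ^[ suc t ]) (box t d) a
    ≡⟨ difference-lin (box t d a) _ ⟨
  box t d a - (Z ^[ suc t ]) (box t d) a
    ≡⟨ D-Y t (box t d) a ⟨
  D (box t (suc d)) a ∎
  where
  -- The factor z of z q becomes qᵗ and uses up one term of the truncation, which leaves J ≥ d.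
  under : tsum t (suc J) (λ σ → Z (β d σ)) ≗ (Z ^[ t ]) (box t d)
  under a = trans (ℤ.+-identityˡ _) (Z^-cong t (tsum-β t d d≤J) a)

-- Diagonal sums and Cauchy products

-- diag b k = ∑_{i + j = k} b i j
diag : (ℕ → Series) → Series
diag b zero    = b 0 0
diag b (suc k) = b (suc k) 0 + diag (λ i j → b i (suc j)) k

diag-cong : ∀ {b b′} → (∀ i → b i ≗ b′ i) → diag b ≗ diag b′
diag-cong e zero    = e 0 0
diag-cong e (suc k) = cong₂ _+_ (e (suc k) 0) (diag-cong (λ i j → e i (suc j)) k)

-- A diagonal of positive index avoids (0, 0), the one place where the two arrays compared in
-- `box-expansion` differ.
diag-cong-suc : ∀ b b′ → (∀ i → b (suc i) ≗ b′ (suc i)) → (∀ j → b 0 (suc j) ≡ b′ 0 (suc j)) →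
                ∀ k → diag b (suc k) ≡ diag b′ (suc k)
diag-cong-suc b b′ e e₀ zero    = cong₂ _+_ (e 0 0) (e₀ 0)
diag-cong-suc b b′ e e₀ (suc k) = cong₂ _+_ (e (suc k) 0)
  (diag-cong-suc (λ i j → b i (suc j)) (λ i j → b′ i (suc j))
                 (λ i j → e i (suc j)) (λ j → e₀ (suc j)) k)

diag-lin : ∀ x y b b′ → diag (λ i j → x * b i j + y * b′ i j)
                      ≗ λ k → x * diag b k + y * diag b′ k
diag-lin x y b b′ zero    = refl
diag-lin x y b b′ (suc k) =
  trans (cong (λ ξ → x * b (suc k) 0 + y * b′ (suc k) 0 + ξ)
              (diag-lin x y (λ i j → b i (suc j)) (λ i j → b′ i (suc j)) k))
        (lemma x y (b (suc k) 0) (b′ (suc k) 0) _ _)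
  where
  lemma : ∀ x y p q p′ q′ → x * p + y * q + (x * p′ + y * q′) ≡ x * (p + p′) + y * (q + q′)
  lemma = solve-∀

diag-scale : ∀ x b → diag (λ i j → x * b i j) ≗ λ k → x * diag b k
diag-scale x b zero    = refl
diag-scale x b (suc k) =
  trans (cong (λ ξ → x * b (suc k) 0 + ξ) (diag-scale x (λ i j → b i (suc j)) k))
        (sym (ℤ.*-distribˡ-+ x (b (suc k) 0) _))

-- With T = t + 1, the coefficient of q^(k T) takes from the j-th summand its entry at τ = (k - j)
-- T. As T is positive, only j ≤ k contribute, and J ≥ k keeps them all.
tsum-diag : ∀ t b {k J} → k ≤ J → tsum (suc t) J b (k ℕ.* suc t) ≡ diag (λ i → b (i ℕ.* suc t)) k
tsum-diag t b {zero}  {zero}  _ = refl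
tsum-diag t b {zero}  {suc J} _ = ℤ.+-identityʳ (b 0 0)
tsum-diag t b {suc k} {suc J} (s≤s k≤J) = cong (λ ξ → b (suc k ℕ.* suc t) 0 + ξ)
  (trans (Z^-shift (suc t) (tsum (suc t) J (λ τ j → b τ (suc j))) (k ℕ.* suc t))
         (tsum-diag t (λ τ j → b τ (suc j)) k≤J))

conv : Series → Series → Series
conv u v = diag (λ i j → v i * u j)

conv-Zˡ : ∀ u v → conv (Z u) v ≗ Z (conv u v)
conv-Zˡ u v zero    = ℤ.*-zeroʳ (v 0)
conv-Zˡ u v (suc k) = trans (cong (_+ conv u v k) (ℤ.*-zeroʳ (v (suc k)))) (ℤ.+-identityˡ (conv u v k))

conv-Zʳ : ∀ u v → conv u (Z v) ≗ Z (conv u v)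
conv-Zʳ u v zero          = ℤ.*-zeroˡ (u 0)
conv-Zʳ u v (suc zero)    = trans (cong (λ ξ → v 0 * u 0 + ξ) (conv-Zʳ (u ∘ suc) v 0)) (ℤ.+-identityʳ _)
conv-Zʳ u v (suc (suc k)) = cong (λ ξ → v (suc k) * u 0 + ξ) (conv-Zʳ (u ∘ suc) v (suc k))

-- A factor 1 - z may sit on either side of a product. This carries the powers of 1 - z from the Lah
-- numbers over to ∑ kᵐ zᵏ.
conv-D : ∀ u v → conv (D u) v ≗ conv u (D v)
conv-D u v k = begin
  conv (D u) v k
    ≡⟨ diag-cong (λ i j → l₁ (v i) (u j) (Z u j)) k ⟩
  diag (λ i j → 1ℤ * (v i * u j) + - 1ℤ * (v i * Z u j)) k
    ≡⟨ diag-lin 1ℤ (- 1ℤ) (λ i j → v i * u j) (λ i j → v i * Z u j) k ⟩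
  1ℤ * conv u v k + - 1ℤ * conv (Z u) v k
    ≡⟨ cong (λ x → 1ℤ * conv u v k + - 1ℤ * x) (trans (conv-Zˡ u v k) (sym (conv-Zʳ u v k))) ⟩
  1ℤ * conv u v k + - 1ℤ * conv u (Z v) k
    ≡⟨ diag-lin 1ℤ (- 1ℤ) (λ i j → v i * u j) (λ i j → Z v i * u j) k ⟨
  diag (λ i j → 1ℤ * (v i * u j) + - 1ℤ * (Z v i * u j)) k
    ≡⟨ diag-cong (λ i j → l₂ (v i) (u j) (Z v i)) k ⟨
  conv u (D v) k ∎
  where
  l₁ : ∀ a b c → a * (b - c) ≡ 1ℤ * (a * b) + - 1ℤ * (a * c)
  l₁ = solve-∀
  l₂ : ∀ a b c → (a - c) * b ≡ 1ℤ * (a * b) + - 1ℤ * (c * b)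
  l₂ = solve-∀

conv-congʳ : ∀ u {v v′} → v ≗ v′ → conv u v ≗ conv u v′
conv-congʳ u e = diag-cong (λ i j → cong (_* u j) (e i))

conv-D^ : ∀ m u v → conv ((D ^[ m ]) u) v ≗ conv u ((D ^[ m ]) v)
conv-D^ zero    u v k = refl
conv-D^ (suc m) u v k =
  trans (conv-D ((D ^[ m ]) u) v k)
        (trans (conv-D^ m u (D v) k) (cong (λ w → conv u w k) (^-inner D m v)))

-- Expansion of the counts in powers of t

horner : ℕ → ℤ → Series → ℤ
horner zero    t a = a 0
horner (suc M) t a = a 0 + t * horner M t (a ∘ suc)

horner-cong : ∀ M t {a b} → a ≗ b → horner M t a ≡ horner M t b
horner-cong zero    t e = e 0
horner-cong (suc M) t e = cong₂ (λ x y → x + t * y) (e 0) (horner-cong M t (e ∘ suc))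

-- A factor τᵐ = (i t)ᵐ in a weighted diagonal sum turns the weight v into tᵐ θᵐ v.
diag-ev : ∀ t M w v k → diag (λ i j → v i * ev (+ (i ℕ.* t)) M w j) k
        ≡ horner M (+ t) (λ m → conv ((D ^[ m ]) (w m)) ((θ ^[ m ]) v) k)
diag-ev t zero    w v k = refl
diag-ev t (suc M) w v k = begin
  diag (λ i j → v i * (w 0 j + + (i ℕ.* t) * ev (+ (i ℕ.* t)) M w′ j)) k
    ≡⟨ diag-cong (λ i j → trans (cong (λ x → v i * (w 0 j + x * ev (+ (i ℕ.* t)) M w′ j)) (ℤ.pos-* i t))
                                (lemma (v i) (w 0 j) (+ i) (+ t) (ev (+ (i ℕ.* t)) M w′ j))) k ⟩
  diag (λ i j → 1ℤ * (v i * w 0 j) + + t * (θ v i * ev (+ (i ℕ.* t)) M w′ j)) k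
    ≡⟨ diag-lin 1ℤ (+ t) (λ i j → v i * w 0 j) (λ i j → θ v i * ev (+ (i ℕ.* t)) M w′ j) k ⟩
  1ℤ * conv (w 0) v k + + t * diag (λ i j → θ v i * ev (+ (i ℕ.* t)) M w′ j) k
    ≡⟨ cong₂ (λ x y → x + + t * y) (ℤ.*-identityˡ (conv (w 0) v k))
         (trans (diag-ev t M w′ (θ v) k) (horner-cong M (+ t) inner)) ⟩
  conv (w 0) v k + + t * horner M (+ t) (λ m → conv ((D ^[ suc m ]) (w (suc m))) ((θ ^[ suc m ]) v) k) ∎
  where
  w′ = λ m → D (w (suc m))
  inner : ∀ m → conv ((D ^[ m ]) (w′ m)) ((θ ^[ m ]) (θ v)) k
              ≡ conv ((D ^[ suc m ]) (w (suc m))) ((θ ^[ suc m ]) v) k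
  inner m = cong₂ (λ x y → conv x y k) (^-inner D m (w (suc m))) (^-inner θ m v)
  lemma : ∀ a b c t e → a * (b + c * t * e) ≡ 1ℤ * (a * b) + t * (c * a * e)
  lemma = solve-∀

-- By `tsum-β` the count is a diagonal sum of values of `β` at multiples of t + 1, each an `ev` of
-- (1 - z) h up to d!. Sorted by powers of t + 1, the m-th term carries (1 - z)^(m+1), which turns ∑
-- kᵐ zᵏ into an Eulerian polynomial.
box-expansion : ∀ t d k {M} → d ≤ M →
  + (d !) * box (suc t) (suc d) (suc k ℕ.* suc t)
  ≡ horner M (+ suc t) (λ m → conv (h⁺ d m) (+∘ eul m) (suc k))
box-expansion t d k {M} d≤M = begin
  + (d !) * box (suc t) (suc d) (suc k ℕ.* suc t)
    -- The truncation has to reach both d + 1 and k + 1; their sum does.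
    ≡⟨ cong (+ (d !) *_) (tsum-β (suc t) (suc d) (ℕ.m≤m+n (suc d) (suc k)) (suc k ℕ.* suc t)) ⟨
  + (d !) * tsum (suc t) (suc d ℕ.+ suc k) (β (suc d)) (suc k ℕ.* suc t)
    ≡⟨ cong (+ (d !) *_) (tsum-diag t (β (suc d)) (ℕ.m≤n+m (suc k) (suc d))) ⟩
  + (d !) * diag (λ i → β (suc d) (i ℕ.* suc t)) (suc k)
    ≡⟨ diag-scale (+ (d !)) (λ i → β (suc d) (i ℕ.* suc t)) (suc k) ⟨
  diag (λ i j → + (d !) * β (suc d) (i ℕ.* suc t) j) (suc k)
    -- For i > 0 the multiple of t + 1 is a successor, as `β-ev` requires. For i = 0 and j > 0 both
    -- sides vanish, since `β (suc d) 0` is `one`.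
    ≡⟨ diag-cong-suc (λ i j → + (d !) * β (suc d) (i ℕ.* suc t) j)
         (λ i j → positive i * ev (+ (i ℕ.* suc t)) M (λ m → D (h⁺ d m)) j)
         (λ i j → β-ev (t ℕ.+ i ℕ.* suc t) j) (λ j → ℤ.*-zeroʳ (+ (d !))) k ⟩
  diag (λ i j → positive i * ev (+ (i ℕ.* suc t)) M (λ m → D (h⁺ d m)) j) (suc k)
    ≡⟨ diag-ev (suc t) M (λ m → D (h⁺ d m)) positive (suc k) ⟩
  horner M (+ suc t) (λ m → conv ((D ^[ m ]) (D (h⁺ d m))) ((θ ^[ m ]) positive) (suc k))
    ≡⟨ horner-cong M (+ suc t) (λ m → trans
         (cong (λ u → conv u ((θ ^[ m ]) positive) (suc k)) (^-inner D m (h⁺ d m)))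
         (trans (conv-D^ (suc m) (h⁺ d m) ((θ ^[ m ]) positive) (suc k))
                (conv-congʳ (h⁺ d m) (D^-θ^ m) (suc k)))) ⟩
  horner M (+ suc t) (λ m → conv (h⁺ d m) (+∘ eul m) (suc k)) ∎
  where
  β-ev : ∀ τ j → + (d !) * β (suc d) (suc τ) j
               ≡ 1ℤ * ev (+ suc τ) M (λ m → D (h⁺ d m)) j
  β-ev τ j = begin
    + (d !) * β (suc d) (suc τ) j
      -- The two readings of `δ` meet here: `β-suc` takes it as a series in q, `D-η` as a series in
      -- p.
      ≡⟨ cong (+ (d !) *_) (trans (β-suc d (suc τ) j) (sym (D-η d τ j))) ⟩
    + (d !) * D (η d (suc τ)) j
      ≡⟨ D-scale (+ (d !)) (η d (suc τ)) j ⟨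
    D (λ i → + (d !) * η d (suc τ) i) j
      ≡⟨ D-cong (ev-h d (suc τ) d≤M) j ⟨
    D (ev (+ suc τ) M (h⁺ d)) j
      ≡⟨ ev-D (+ suc τ) M (h⁺ d) j ⟨
    ev (+ suc τ) M (λ m → D (h⁺ d m)) j
      ≡⟨ ℤ.*-identityˡ _ ⟨
    1ℤ * ev (+ suc τ) M (λ m → D (h⁺ d m)) j ∎

horner-lin : ∀ M t x y a b → horner M t (λ m → x * a m + y * b m)
                           ≡ x * horner M t a + y * horner M t b
horner-lin zero    t x y a b = refl
horner-lin (suc M) t x y a b =
  trans (cong (λ ξ → x * a 0 + y * b 0 + t * ξ) (horner-lin M t x y (a ∘ suc) (b ∘ suc)))
        (lemma t x y (a 0) (b 0) _ _)
  where
  lemma : ∀ t x y p q p′ q′ → x * p + y * q + t * (x * p′ + y * q′) ≡ x * (p + t * p′) + y * (q + t * q′)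
  lemma = solve-∀

-- Positivity of the coefficients

-- Like `hornerℕ`, a copy over ℕ, where a sum is positive as soon as one term is.
convℕ : (ℕ → ℕ) → (ℕ → ℕ) → ℕ → ℕ
convℕ u v zero    = v 0 ℕ.* u 0
convℕ u v (suc k) = v (suc k) ℕ.* u 0 ℕ.+ convℕ (u ∘ suc) v k

conv-+∘ : ∀ u v k → conv (+∘ u) (+∘ v) k ≡ + convℕ u v k
conv-+∘ u v zero    = sym (ℤ.pos-* (v 0) (u 0))
conv-+∘ u v (suc k) = cong₂ _+_ (sym (ℤ.pos-* (v (suc k)) (u 0))) (conv-+∘ (u ∘ suc) v k)

convℕ-pos : ∀ u v j i → 0 ℕ.< u j → 0 ℕ.< v i → 0 ℕ.< convℕ u v (j ℕ.+ i)
convℕ-pos u v zero    zero    0<u 0<v = ℕ.*-mono-≤ 0<v 0<u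
convℕ-pos u v zero    (suc i) 0<u 0<v = ℕ.≤-trans (ℕ.*-mono-≤ 0<v 0<u) (ℕ.m≤m+n _ _)
convℕ-pos u v (suc j) i       0<u 0<v =
  ℕ.≤-trans (convℕ-pos (u ∘ suc) v j i 0<u 0<v) (ℕ.m≤n+m _ (v (suc (j ℕ.+ i)) ℕ.* u 0))

hornerℕ : ℕ → ℕ → (ℕ → ℕ) → ℕ
hornerℕ zero    t a = a 0
hornerℕ (suc M) t a = a 0 ℕ.+ t ℕ.* hornerℕ M t (a ∘ suc)

horner-+∘ : ∀ M t a → horner M (+ t) (+∘ a) ≡ + hornerℕ M t a
horner-+∘ zero    t a = refl
horner-+∘ (suc M) t a = cong (λ ξ → + a 0 + ξ)
  (trans (cong (+ t *_) (horner-+∘ M t (a ∘ suc))) (sym (ℤ.pos-* t (hornerℕ M t (a ∘ suc)))))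

-- d! times the coefficients of the Ehrhart polynomial of the hypersimplex Δ_{k,d+1}.
hypersimplexCoeff : ℕ → ℕ → ℕ → ℕ
hypersimplexCoeff d k m = convℕ (h d m) (eul m) k

-- The coefficients of (d + 1 + k t) d! ehr(Δ_{k,d+1}, t), where `shift` is multiplication by t.
panhandleCoeff : ℕ → ℕ → ℕ → ℕ
panhandleCoeff d k m = suc d ℕ.* hypersimplexCoeff d k m ℕ.+ k ℕ.* shift (hypersimplexCoeff d k) m

panhandle-expansion : ∀ t d k → + (suc d !) * panhandle (suc t) d (suc k ℕ.* suc t)
                              ≡ + hornerℕ (suc d) (suc t) (panhandleCoeff d (suc k))
panhandle-expansion t d k = begin
  + (suc d !) * panhandle T d (K ℕ.* T)
    ≡⟨ cong (_* panhandle T d (K ℕ.* T)) (ℤ.pos-* (suc d) (d !)) ⟩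
  + suc d * + (d !) * panhandle T d (K ℕ.* T)
    ≡⟨ l₁ (+ suc d) (+ (d !)) (panhandle T d (K ℕ.* T)) ⟩
  + (d !) * (+ suc d * panhandle T d (K ℕ.* T))
    ≡⟨ cong (+ (d !) *_) (panhandle-box T d (K ℕ.* T)) ⟩
  + (d !) * ((+ suc d + + (K ℕ.* T)) * B)
    ≡⟨ cong (λ x → + (d !) * ((+ suc d + x) * B)) (ℤ.pos-* K T) ⟩
  + (d !) * ((+ suc d + + K * + T) * B)
    ≡⟨ l₂ (+ (d !)) (+ suc d) (+ K) (+ T) B ⟩
  + suc d * (+ (d !) * B) + + K * (+ T * (+ (d !) * B))
    -- The second copy is expanded only up to degree d because the factor T still raises its degree
    -- by one.
    ≡⟨ cong₂ (λ x y → + suc d * x + + K * (+ T * y)) (expansion (ℕ.n≤1+n d)) (expansion ℕ.≤-refl) ⟩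
  + suc d * horner (suc d) (+ T) (+∘ P) + + K * (+ T * horner d (+ T) (+∘ P))
    ≡⟨ cong (λ x → + suc d * horner (suc d) (+ T) (+∘ P) + + K * x) (ℤ.+-identityˡ _) ⟨
  + suc d * horner (suc d) (+ T) (+∘ P) + + K * horner (suc d) (+ T) (+∘ shift P)
    ≡⟨ horner-lin (suc d) (+ T) (+ suc d) (+ K) (+∘ P) (+∘ shift P) ⟨
  horner (suc d) (+ T) (λ m → + suc d * + P m + + K * + shift P m)
    ≡⟨ horner-cong (suc d) (+ T) (λ m → cong₂ _+_ (ℤ.pos-* (suc d) (P m)) (ℤ.pos-* K (shift P m))) ⟨
  horner (suc d) (+ T) (+∘ panhandleCoeff d K)
    ≡⟨ horner-+∘ (suc d) T (panhandleCoeff d K) ⟩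
  + hornerℕ (suc d) T (panhandleCoeff d K) ∎
  where
  K T : ℕ
  K = suc k
  T = suc t
  P : ℕ → ℕ
  P = hypersimplexCoeff d K
  B : ℤ
  B = box T (suc d) (K ℕ.* T)
  expansion : ∀ {M} → d ≤ M → + (d !) * B ≡ horner M (+ T) (+∘ P)
  expansion {M} d≤M = trans (box-expansion t d k d≤M)
                            (horner-cong M (+ T) (λ m → conv-+∘ (h d m) (eul m) K))
  l₁ : ∀ a b x → a * b * x ≡ b * (a * x)
  l₁ = solve-∀
  l₂ : ∀ f a k t x → f * ((a + k * t) * x) ≡ a * (f * x) + k * (t * (f * x))
  l₂ = solve-∀

-- One positive product with j + i = k + 1 suffices. The Lah factor is positive for j ≤ d - m, the
-- Eulerian factor for i = 1 and for 1 ≤ i ≤ m. If j = k is admissible, i = 1 works; otherwise j is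
-- taken as large as possible.
hypersimplexCoeff-pos : ∀ d k m → m ≤ d → m ℕ.+ k ≤ d ⊎ k ℕ.< d →
                        0 ℕ.< hypersimplexCoeff d (suc k) m
hypersimplexCoeff-pos d k m m≤d k-small with ℕ.≤-<-connex (m ℕ.+ k) d
... | inj₁ m+k≤d = subst (λ i → 0 ℕ.< hypersimplexCoeff d i m) (ℕ.+-comm k 1)
  (convℕ-pos (h d m) (eul m) k 1 (h-pos d m k m+k≤d) (eul-pos₁ m))
... | inj₂ m+k>d with k-small
...   | inj₁ m+k≤d = contradiction m+k≤d (ℕ.<⇒≱ m+k>d)
...   | inj₂ k<d = subst (λ i → 0 ℕ.< hypersimplexCoeff d i m) e+i≡k
  (convℕ-pos (h d m) (eul m) e (suc i)
    (h-pos d m e (ℕ.≤-reflexive (ℕ.m+[n∸m]≡n m≤d)))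
    (eul-pos m i (ℕ.+-cancelˡ-≤ e (suc i) m
      (ℕ.≤-trans (ℕ.≤-reflexive e+i≡k)
        (ℕ.≤-trans k<d (ℕ.≤-reflexive (sym (ℕ.m∸n+n≡m m≤d))))))))
  where
  -- The largest j that `h-pos` allows, and one less than the Eulerian index. Since m + k > d, the
  -- subtraction k ∸ e is exact, and k < d gives i < m.
  e i : ℕ
  e = d ∸ m
  i = k ∸ e
  e+i≡k : e ℕ.+ suc i ≡ suc k
  e+i≡k = trans (ℕ.+-suc e i) (cong suc (ℕ.m+[n∸m]≡n (ℕ.m≤n+o⇒m∸n≤o d m (ℕ.<⇒≤ m+k>d))))

-- For m = 0 the first summand is positive, for m > 0 the second, which involves the hypersimplex
-- coefficient of degree m - 1. In the second case of the hypothesis the hypersimplex is a point, so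
-- only its constant coefficient is available.
panhandleCoeff-pos : ∀ d k m → (suc k ≤ d × m ≤ suc d) ⊎ (suc k ≡ suc d × m ≤ 1) →
                     0 ℕ.< panhandleCoeff d (suc k) m
panhandleCoeff-pos d k zero c =
  ℕ.≤-trans (hypersimplexCoeff-pos d k 0 z≤n (bound c))
    (ℕ.≤-trans (ℕ.m≤n*m _ (suc d)) (ℕ.m≤m+n _ _))
  where
  bound : (suc k ≤ d × 0 ≤ suc d) ⊎ (suc k ≡ suc d × 0 ≤ 1) → k ≤ d ⊎ k ℕ.< d
  bound (inj₁ (k<d , _))  = inj₂ k<d
  bound (inj₂ (refl , _)) = inj₁ ℕ.≤-refl
panhandleCoeff-pos d k (suc m) c =
  ℕ.≤-trans (previous c)
    (ℕ.≤-trans (ℕ.m≤n*m _ (suc k)) (ℕ.m≤n+m _ (suc d ℕ.* hypersimplexCoeff d (suc k) (suc m))))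
  where
  previous : (suc k ≤ d × suc m ≤ suc d) ⊎ (suc k ≡ suc d × suc m ≤ 1) →
             0 ℕ.< hypersimplexCoeff d (suc k) m
  previous (inj₁ (k<d , s≤s m≤d))   = hypersimplexCoeff-pos d k m m≤d (inj₂ k<d)
  previous (inj₂ (refl , s≤s z≤n)) = hypersimplexCoeff-pos d d 0 z≤n (inj₁ ℕ.≤-refl)

-- Enumeration of the lattice points

toℤ : ∀ {n} → Vec ℕ n → Vec ℤ n
toℤ = Vec.map (λ a → + a)

incHead : ∀ {n} → Vec ℕ (suc n) → Vec ℕ (suc n)
incHead (x ∷ v) = suc x ∷ v

-- prepend r f a lists the vectors x ∷ v with x ≤ r and v in f (a - x).
prepend : ∀ {n} → ℕ → (ℕ → List (Vec ℕ n)) → ℕ → List (Vec ℕ (suc n))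
prepend zero    f a       = map (0 ∷_) (f a)
prepend (suc r) f zero    = map (0 ∷_) (f 0)
prepend (suc r) f (suc a) = map (0 ∷_) (f (suc a)) ++ map incHead (prepend r f a)

∈-prepend⁺ : ∀ {n} r (f : ℕ → List (Vec ℕ n)) {x b v} → x ≤ r → v ∈ f b → (x ∷ v) ∈ prepend r f (x ℕ.+ b)
∈-prepend⁺ zero    f z≤n v∈ = ∈-map⁺ (0 ∷_) v∈
∈-prepend⁺ (suc r) f {b = zero}  z≤n v∈ = ∈-map⁺ (0 ∷_) v∈
∈-prepend⁺ (suc r) f {b = suc b} z≤n v∈ = ∈-++⁺ˡ (∈-map⁺ (0 ∷_) v∈)
∈-prepend⁺ (suc r) f {suc x} {b} (s≤s x≤r) v∈ =
  ∈-++⁺ʳ (map (0 ∷_) (f (suc x ℕ.+ b))) (∈-map⁺ incHead (∈-prepend⁺ r f x≤r v∈))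

∈-prepend⁻ : ∀ {n} r (f : ℕ → List (Vec ℕ n)) a {x v} → (x ∷ v) ∈ prepend r f a →
             ∃[ b ] x ≤ r × a ≡ x ℕ.+ b × v ∈ f b
∈-prepend⁻ zero f a w∈ with ∈-map⁻ (0 ∷_) w∈
... | v , v∈ , refl = a , z≤n , refl , v∈
∈-prepend⁻ (suc r) f zero w∈ with ∈-map⁻ (0 ∷_) w∈
... | v , v∈ , refl = 0 , z≤n , refl , v∈
∈-prepend⁻ (suc r) f (suc a) w∈ with ∈-++⁻ (map (0 ∷_) (f (suc a))) w∈
... | inj₁ w∈₀ with ∈-map⁻ (0 ∷_) w∈₀
...   | v , v∈ , refl = suc a , z≤n , refl , v∈
∈-prepend⁻ (suc r) f (suc a) w∈ | inj₂ w∈₁ with ∈-map⁻ incHead w∈₁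
...   | (x ∷ v) , xv∈ , refl with ∈-prepend⁻ r f a xv∈
...     | b , x≤r , refl , v∈ = b , s≤s x≤r , refl , v∈

prepend-unique : ∀ {n} r (f : ℕ → List (Vec ℕ n)) → (∀ b → Unique (f b)) → ∀ a → Unique (prepend r f a)
prepend-unique zero    f u a       = Unique.map⁺ Vec.∷-injectiveʳ (u a)
prepend-unique (suc r) f u zero    = Unique.map⁺ Vec.∷-injectiveʳ (u 0)
prepend-unique (suc r) f u (suc a) =
  Unique.++⁺ (Unique.map⁺ Vec.∷-injectiveʳ (u (suc a)))
             (Unique.map⁺ incHead-injective (prepend-unique r f u a)) disjoint
  where
  incHead-injective : ∀ {n} {v w : Vec ℕ (suc n)} → incHead v ≡ incHead w → v ≡ w
  incHead-injective {v = x ∷ v} {w = .x ∷ .v} refl = refl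
  disjoint : Disjoint (map (0 ∷_) (f (suc a))) (map incHead (prepend r f a))
  disjoint (w∈ , w∈′) with ∈-map⁻ (0 ∷_) w∈ | ∈-map⁻ incHead w∈′
  ... | v , _ , refl | (x ∷ v′) , _ , ()

-- The clauses of `prepend` follow those of `Y`: head 0 gives f, and raising the head is a shift.
prepend-length : ∀ {n} r (f : ℕ → List (Vec ℕ n)) a → + length (prepend r f a)
                                                          ≡ Y r (λ b → + length (f b)) a
prepend-length zero f a = cong +_ (List.length-map (0 ∷_) (f a))
prepend-length (suc r) f zero = trans (cong +_ (List.length-map (0 ∷_) (f 0))) (sym (ℤ.+-identityʳ _))
prepend-length (suc r) f (suc a) = begin
  + length (map (0 ∷_) (f (suc a)) ++ map incHead (prepend r f a))
    ≡⟨ cong +_ (List.length-++ (map (0 ∷_) (f (suc a)))) ⟩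
  + length (map (0 ∷_) (f (suc a))) ℤ.+ + length (map incHead (prepend r f a))
    ≡⟨ cong₂ (λ x y → + x ℤ.+ + y) (List.length-map (0 ∷_) (f (suc a)))
         (List.length-map incHead (prepend r f a)) ⟩
  + length (f (suc a)) ℤ.+ + length (prepend r f a)
    ≡⟨ cong (λ x → + length (f (suc a)) ℤ.+ x) (prepend-length r f a) ⟩
  + length (f (suc a)) ℤ.+ Y r (λ b → + length (f b)) a ∎

singletons : ℕ → List (Vec ℕ 1)
singletons b = (b ∷ []) ∷ []

-- The last two coordinates are bounded only through their sum, which is all that remains of a.
-- Hence a single test a ≤ t, followed by every splitting of a.
points : ℕ → ∀ d → ℕ → List (Vec ℕ (suc (suc d)))
points t zero a with a ℕ.≤? t
... | yes _ = prepend a singletons a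
... | no  _ = []
points t (suc d) a = prepend t (points t d) a

points-unique : ∀ t d a → Unique (points t d a)
points-unique t zero a with a ℕ.≤? t
... | yes _ = prepend-unique a singletons (λ _ → [] ∷ []) a
... | no  _ = []
points-unique t (suc d) a = prepend-unique t (points t d) (points-unique t d) a

box₁ : ∀ {t a} → a ≤ t → Y t one a ≡ 1ℤ
box₁ {zero}  {zero}  _         = refl
box₁ {suc t} {zero}  _         = refl
box₁ {suc t} {suc a} (s≤s a≤t) = trans (ℤ.+-identityˡ _) (box₁ a≤t)

box₁-vanish : ∀ {t a} → t ℕ.< a → Y t one a ≡ 0ℤ
box₁-vanish {zero}  {suc a} _         = refl
box₁-vanish {suc t} {suc a} (s≤s t<a) = trans (ℤ.+-identityˡ _) (box₁-vanish t<a)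

-- Both sides obey the same recursion in d. For d = 0 the weight a + 1 counts the splittings, and
-- `box₁` and `box₁-vanish` account for the test a ≤ t.
points-length : ∀ t d a → + length (points t d a) ≡ panhandle t d a
points-length t zero a with a ℕ.≤? t
... | yes a≤t rewrite box₁ a≤t =
  trans (prepend-length a singletons a) (trans (Y-ones a a ℕ.≤-refl) (lemma (+ a)))
  where
  Y-ones : ∀ r a → a ≤ r → Y r (λ _ → 1ℤ) a ≡ + suc a
  Y-ones zero    zero    _         = refl
  Y-ones (suc r) zero    _         = refl
  Y-ones (suc r) (suc a) (s≤s a≤r) = cong (λ x → 1ℤ ℤ.+ x) (Y-ones r a a≤r)
  lemma : ∀ A → 1ℤ ℤ.+ A ≡ A ℤ.* 1ℤ ℤ.+ 1ℤ
  lemma = solve-∀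
... | no a≰t rewrite box₁-vanish (ℕ.≰⇒> a≰t) = lemma (+ a)
  where
  lemma : ∀ A → 0ℤ ≡ A ℤ.* 0ℤ ℤ.+ 0ℤ
  lemma = solve-∀
points-length t (suc d) a = trans (prepend-length t (points t d) a) (Y-cong t (points-length t d) a)

-- The conditions of `Δ` multiplied by t, with a in place of k t; nonnegativity is built into ℕ.
record InΔ (t d a : ℕ) (w : Vec ℕ (suc (suc d))) : Set where
  constructor mkInΔ
  field
    total     : Vec.sum w ≡ a
    ≤t        : ∀ i → suc (toℕ i) ≤ d → lookup w i ≤ t
    lastTwo≤t : ∀ i j → ℕ.suc (toℕ i) ≡ suc d → ℕ.suc (toℕ j) ≡ suc (suc d) →
                lookup w i ℕ.+ lookup w j ≤ t

points-sound : ∀ t d a w → w ∈ points t d a → InΔ t d a w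
points-sound t zero a (x ∷ v) w∈ with a ℕ.≤? t
... | yes a≤t with ∈-prepend⁻ a singletons a w∈
...   | y , _ , refl , here refl = mkInΔ (cong (x ℕ.+_) (ℕ.+-identityʳ y)) (λ _ ()) λ where
        zero       (suc zero) _  _  → a≤t
        zero       zero       _  ()
        (suc zero) _          () _
points-sound t (suc d) a (x ∷ v) w∈ with ∈-prepend⁻ t (points t d) a w∈
... | b , x≤t , refl , v∈ = mkInΔ (cong (x ℕ.+_) total)
        (λ where
          zero    _         → x≤t
          (suc i) (s≤s i<d) → ≤t i i<d)
        (λ where
          (suc i) (suc j) i≡ j≡ → lastTwo≤t i j (ℕ.suc-injective i≡) (ℕ.suc-injective j≡)
          zero    _       () _
          (suc _) zero    _  ())
  where open InΔ (points-sound t d b v v∈)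

points-complete : ∀ t d a w → InΔ t d a w → w ∈ points t d a
points-complete t zero .(x ℕ.+ (y ℕ.+ 0)) (x ∷ y ∷ []) (mkInΔ refl _ x+y≤t) with (x ℕ.+ (y ℕ.+ 0)) ℕ.≤? t
... | yes _ = ∈-prepend⁺ _ singletons (ℕ.m≤m+n x (y ℕ.+ 0)) (here (cong (_∷ []) (sym (ℕ.+-identityʳ y))))
... | no ≰t = contradiction
  (ℕ.≤-trans (ℕ.≤-reflexive (cong (x ℕ.+_) (ℕ.+-identityʳ y))) (x+y≤t zero (suc zero) refl refl)) ≰t
points-complete t (suc d) .(x ℕ.+ Vec.sum v) (x ∷ v) (mkInΔ refl ≤t lastTwo≤t) =
  ∈-prepend⁺ t (points t d) (≤t zero (s≤s z≤n))
    (points-complete t d (Vec.sum v) v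
      (mkInΔ refl (λ i i<d → ≤t (suc i) (s≤s i<d))
        (λ i j i≡ j≡ → lastTwo≤t (suc i) (suc j) (cong suc i≡) (cong suc j≡))))

-- Integers inside the rationals

-- `ℤ→ℚ` normalises its fraction, so arithmetic and order are transferred through unnormalised
-- rationals, where the image of z is z / 1.
toℚᵘ-ℤ→ℚ : ∀ z → ℚ.toℚᵘ (ℤ→ℚ z) ℚᵘ.≃ mkℚᵘ z 0
toℚᵘ-ℤ→ℚ z = ℚ.toℚᵘ-fromℚᵘ (mkℚᵘ z 0)

ℤ→ℚ-+ : ∀ x y → ℤ→ℚ (x ℤ.+ y) ≡ ℤ→ℚ x ℚ.+ ℤ→ℚ y
ℤ→ℚ-+ x y = ℚ.toℚᵘ-injective (ℚᵘ.≃-trans (toℚᵘ-ℤ→ℚ (x ℤ.+ y)) (ℚᵘ.≃-trans (*≡* (lemma x y))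
  (ℚᵘ.≃-sym (ℚᵘ.≃-trans (ℚ.toℚᵘ-homo-+ (ℤ→ℚ x) (ℤ→ℚ y)) (ℚᵘ.+-cong (toℚᵘ-ℤ→ℚ x) (toℚᵘ-ℤ→ℚ y))))))
  where
  lemma : ∀ x y → (x ℤ.+ y) ℤ.* 1ℤ ≡ (x ℤ.* 1ℤ ℤ.+ y ℤ.* 1ℤ) ℤ.* 1ℤ
  lemma = solve-∀

ℤ→ℚ-* : ∀ x y → ℤ→ℚ (x ℤ.* y) ≡ ℤ→ℚ x ℚ.* ℤ→ℚ y
ℤ→ℚ-* x y = ℚ.toℚᵘ-injective (ℚᵘ.≃-trans (toℚᵘ-ℤ→ℚ (x ℤ.* y))
  (ℚᵘ.≃-sym (ℚᵘ.≃-trans (ℚ.toℚᵘ-homo-* (ℤ→ℚ x) (ℤ→ℚ y)) (ℚᵘ.*-cong (toℚᵘ-ℤ→ℚ x) (toℚᵘ-ℤ→ℚ y)))))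

ℤ→ℚ-cancel-≤ : ∀ {x y} → ℤ→ℚ x ℚ.≤ ℤ→ℚ y → x ℤ.≤ y
ℤ→ℚ-cancel-≤ {x} {y} p
  with ℚᵘ.≤-respʳ-≃ (toℚᵘ-ℤ→ℚ y) (ℚᵘ.≤-respˡ-≃ (toℚᵘ-ℤ→ℚ x) (ℚ.toℚᵘ-mono-≤ p))
... | *≤* q = ℤ.*-cancelʳ-≤-pos x y 1ℤ q

ℤ→ℚ-mono-≤ : ∀ {x y} → x ℤ.≤ y → ℤ→ℚ x ℚ.≤ ℤ→ℚ y
ℤ→ℚ-mono-≤ {x} {y} p = ℚ.toℚᵘ-cancel-≤
  (ℚᵘ.≤-respʳ-≃ (ℚᵘ.≃-sym (toℚᵘ-ℤ→ℚ y)) (ℚᵘ.≤-respˡ-≃ (ℚᵘ.≃-sym (toℚᵘ-ℤ→ℚ x))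
    (*≤* (ℤ.*-monoʳ-≤-nonNeg 1ℤ p))))

ℤ→ℚ-injective : ∀ {x y} → ℤ→ℚ x ≡ ℤ→ℚ y → x ≡ y
ℤ→ℚ-injective e = ℤ.≤-antisym (ℤ→ℚ-cancel-≤ (ℚ.≤-reflexive e)) (ℤ→ℚ-cancel-≤ (ℚ.≤-reflexive (sym e)))

ℕ→ℚ-* : ∀ m n → ℕ→ℚ (m ℕ.* n) ≡ ℕ→ℚ m ℚ.* ℕ→ℚ n
ℕ→ℚ-* m n = trans (cong ℤ→ℚ (ℤ.pos-* m n)) (ℤ→ℚ-* (+ m) (+ n))

ℕ→ℚ-pos : ∀ {n} → 0 ℕ.< n → ℚ.Positive (ℕ→ℚ n)
ℕ→ℚ-pos {suc n} _ = ℚ.normalize-pos (suc n) 1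

*-cancelˡ-≡-pos : ∀ r .{{_ : ℚ.Positive r}} {p q} → r ℚ.* p ≡ r ℚ.* q → p ≡ q
*-cancelˡ-≡-pos r e = ℚ.≤-antisym (ℚ.*-cancelˡ-≤-pos r (ℚ.≤-reflexive e))
                                  (ℚ.*-cancelˡ-≤-pos r (ℚ.≤-reflexive (sym e)))

*-1/-cancel : ∀ r .{{_ : ℚ.NonZero r}} q → r ℚ.* (ℚ.1/ r ℚ.* q) ≡ q
*-1/-cancel r q = begin
  r ℚ.* (ℚ.1/ r ℚ.* q)  ≡⟨ ℚ.*-assoc r (ℚ.1/ r) q ⟨
  r ℚ.* ℚ.1/ r ℚ.* q    ≡⟨ cong (ℚ._* q) (ℚ.*-inverseʳ r) ⟩
  1ℚ ℚ.* q              ≡⟨ ℚ.*-identityˡ q ⟩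
  q                     ∎

foldr-scale : ∀ {n} c (x : Vec ℚ n) → foldr′ ℚ._+_ 0ℚ (Vec.map (c ℚ.*_) x) ≡ c ℚ.* foldr′ ℚ._+_ 0ℚ x
foldr-scale c []      = sym (ℚ.*-zeroʳ c)
foldr-scale c (a ∷ x) = trans (cong (c ℚ.* a ℚ.+_) (foldr-scale c x)) (sym (ℚ.*-distribˡ-+ c a _))

foldr-ℕ→ℚ : ∀ {n} (w : Vec ℕ n) → foldr′ ℚ._+_ 0ℚ (Vec.map ℤ→ℚ (toℤ w)) ≡ ℕ→ℚ (Vec.sum w)
foldr-ℕ→ℚ []      = refl
foldr-ℕ→ℚ (a ∷ w) = trans (cong (ℕ→ℚ a ℚ.+_) (foldr-ℕ→ℚ w)) (sym (ℤ→ℚ-+ (+ a) (+ Vec.sum w)))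

lookup-ℕ→ℚ : ∀ {n} c (w : Vec ℕ n) x → Vec.map ℤ→ℚ (toℤ w) ≡ Vec.map (c ℚ.*_) x →
             ∀ i → ℕ→ℚ (lookup w i) ≡ c ℚ.* lookup x i
lookup-ℕ→ℚ c w x e i = begin
  ℕ→ℚ (lookup w i)                              ≡⟨ cong ℤ→ℚ (Vec.lookup-map i (λ a → + a) w) ⟨
  ℤ→ℚ (lookup (toℤ w) i)                 ≡⟨ Vec.lookup-map i ℤ→ℚ (toℤ w) ⟨
  lookup (Vec.map ℤ→ℚ (toℤ w)) i         ≡⟨ cong (λ v → lookup v i) e ⟩
  lookup (Vec.map (c ℚ.*_) x) i             ≡⟨ Vec.lookup-map i (c ℚ.*_) x ⟩
  c ℚ.* lookup x i                          ∎

nonneg-vector : ∀ {n} (z : Vec ℤ n) → (∀ i → 0ℚ ℚ.≤ ℤ→ℚ (lookup z i)) → ∃[ w ] z ≡ toℤ w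
nonneg-vector []           z≥0 = [] , refl
nonneg-vector (+ x ∷ z)    z≥0 with nonneg-vector z (z≥0 ∘ suc)
... | w , refl = x ∷ w , refl
nonneg-vector (-[1+ x ] ∷ z) z≥0 with ℤ→ℚ-cancel-≤ {0ℤ} { -[1+ x ]} (z≥0 zero)
... | ()

-- Lattice points of the dilated polytope

module _ (s : ℕ) where

  private
    t : ℕ
    t = suc s
    instance
      t-pos : ℚ.Positive (ℕ→ℚ t)
      t-pos = ℕ→ℚ-pos {t} (s≤s z≤n)
      t-nonZero : ℚ.NonZero (ℕ→ℚ t)
      t-nonZero = ℚ.pos⇒nonZero (ℕ→ℚ t)
      t-nonNeg : ℚ.NonNegative (ℕ→ℚ t)
      t-nonNeg = ℚ.pos⇒nonNeg (ℕ→ℚ t)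

  module _ (d k : ℕ) (x : Vec ℚ (suc (suc d))) (w : Vec ℕ (suc (suc d)))
           (w≡tx : Vec.map ℤ→ℚ (toℤ w) ≡ Vec.map (ℕ→ℚ t ℚ.*_) x) where

    private
      coordinate : ∀ i → ℕ→ℚ (lookup w i) ≡ ℕ→ℚ t ℚ.* lookup x i
      coordinate = lookup-ℕ→ℚ (ℕ→ℚ t) w x w≡tx

      sum-scaled : ℕ→ℚ (Vec.sum w) ≡ ℕ→ℚ t ℚ.* foldr′ ℚ._+_ 0ℚ x
      sum-scaled = trans (sym (foldr-ℕ→ℚ w)) (trans (cong (foldr′ ℚ._+_ 0ℚ) w≡tx) (foldr-scale (ℕ→ℚ t) x))

      pair : ∀ i j → ℕ→ℚ (lookup w i ℕ.+ lookup w j) ≡ ℕ→ℚ t ℚ.* (lookup x i ℚ.+ lookup x j)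
      pair i j = begin
        ℕ→ℚ (lookup w i ℕ.+ lookup w j)
          ≡⟨ ℤ→ℚ-+ (+ lookup w i) (+ lookup w j) ⟩
        ℕ→ℚ (lookup w i) ℚ.+ ℕ→ℚ (lookup w j)
          ≡⟨ cong₂ ℚ._+_ (coordinate i) (coordinate j) ⟩
        ℕ→ℚ t ℚ.* lookup x i ℚ.+ ℕ→ℚ t ℚ.* lookup x j
          ≡⟨ ℚ.*-distribˡ-+ (ℕ→ℚ t) (lookup x i) (lookup x j) ⟨
        ℕ→ℚ t ℚ.* (lookup x i ℚ.+ lookup x j) ∎

      ≤1⇒≤t : ∀ n {q} → ℕ→ℚ n ≡ ℕ→ℚ t ℚ.* q → q ℚ.≤ 1ℚ → n ≤ t
      ≤1⇒≤t n e q≤1 = ℤ.drop‿+≤+ (ℤ→ℚ-cancel-≤ (ℚ.≤-trans (ℚ.≤-reflexive e)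
        (ℚ.≤-trans (ℚ.*-monoˡ-≤-nonNeg (ℕ→ℚ t) q≤1) (ℚ.≤-reflexive (ℚ.*-identityʳ (ℕ→ℚ t))))))

      ≤t⇒≤1 : ∀ n {q} → ℕ→ℚ n ≡ ℕ→ℚ t ℚ.* q → n ≤ t → q ℚ.≤ 1ℚ
      ≤t⇒≤1 n e n≤t = ℚ.*-cancelˡ-≤-pos (ℕ→ℚ t) (ℚ.≤-trans (ℚ.≤-reflexive (sym e))
        (ℚ.≤-trans (ℤ→ℚ-mono-≤ (ℤ.+≤+ n≤t)) (ℚ.≤-reflexive (sym (ℚ.*-identityʳ (ℕ→ℚ t))))))

    Δ⇒InΔ : Δ (suc (suc d)) k x → InΔ t d (k ℕ.* t) w
    Δ⇒InΔ x∈Δ = record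
      { total     = ℤ.+-injective (ℤ→ℚ-injective (begin
          ℕ→ℚ (Vec.sum w)                ≡⟨ sum-scaled ⟩
          ℕ→ℚ t ℚ.* foldr′ ℚ._+_ 0ℚ x    ≡⟨ cong (ℕ→ℚ t ℚ.*_) total ⟩
          ℕ→ℚ t ℚ.* ℕ→ℚ k                ≡⟨ ℚ.*-comm (ℕ→ℚ t) (ℕ→ℚ k) ⟩
          ℕ→ℚ k ℚ.* ℕ→ℚ t                ≡⟨ ℕ→ℚ-* k t ⟨
          ℕ→ℚ (k ℕ.* t)                  ∎))
      ; ≤t        = λ i i<d → ≤1⇒≤t (lookup w i) (coordinate i) (≤1 i i<d)
      ; lastTwo≤t = λ i j i≡ j≡ → ≤1⇒≤t (lookup w i ℕ.+ lookup w j) (pair i j) (lastTwo≤1 i j i≡ j≡)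
      }
      where open Δ x∈Δ

    InΔ⇒Δ : InΔ t d (k ℕ.* t) w → Δ (suc (suc d)) k x
    InΔ⇒Δ w∈ = record
      { nonneg    = λ i → ℚ.*-cancelˡ-≤-pos (ℕ→ℚ t) (ℚ.≤-trans (ℚ.≤-reflexive (ℚ.*-zeroʳ (ℕ→ℚ t)))
          (ℚ.≤-trans (ℤ→ℚ-mono-≤ {0ℤ} {+ lookup w i} (ℤ.+≤+ z≤n)) (ℚ.≤-reflexive (coordinate i))))
      ; total     = *-cancelˡ-≡-pos (ℕ→ℚ t) (begin
          ℕ→ℚ t ℚ.* foldr′ ℚ._+_ 0ℚ x    ≡⟨ sum-scaled ⟨
          ℕ→ℚ (Vec.sum w)                ≡⟨ cong ℕ→ℚ total ⟩
          ℕ→ℚ (k ℕ.* t)                  ≡⟨ ℕ→ℚ-* k t ⟩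
          ℕ→ℚ k ℚ.* ℕ→ℚ t                ≡⟨ ℚ.*-comm (ℕ→ℚ k) (ℕ→ℚ t) ⟩
          ℕ→ℚ t ℚ.* ℕ→ℚ k                ∎)
      ; ≤1        = λ i i<d → ≤t⇒≤1 (lookup w i) (coordinate i) (≤t i i<d)
      ; lastTwo≤1 = λ i j i≡ j≡ → ≤t⇒≤1 (lookup w i ℕ.+ lookup w j) (pair i j) (lastTwo≤t i j i≡ j≡)
      }
      where open InΔ w∈

  latticePoints⇔points : ∀ d k z →
    z ∈ map toℤ (points t d (k ℕ.* t)) ⇔ latticePoints (dilate t (Δ (suc (suc d)) k)) z
  latticePoints⇔points d k z = mk⇔ to from
    where
    to : z ∈ map toℤ (points t d (k ℕ.* t)) → latticePoints (dilate t (Δ (suc (suc d)) k)) z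
    to z∈ with ∈-map⁻ toℤ z∈
    ... | w , w∈ , refl = x , InΔ⇒Δ d k x w w≡tx (points-sound t d (k ℕ.* t) w w∈) , w≡tx
      where
      x : Vec ℚ (suc (suc d))
      x = Vec.map (ℚ.1/ ℕ→ℚ t ℚ.*_) (Vec.map ℤ→ℚ (toℤ w))
      w≡tx : Vec.map ℤ→ℚ (toℤ w) ≡ Vec.map (ℕ→ℚ t ℚ.*_) x
      w≡tx = begin
        y                                                      ≡⟨ Vec.map-id y ⟨
        Vec.map id y                                           ≡⟨ Vec.map-cong (sym ∘ *-1/-cancel (ℕ→ℚ t)) y ⟩
        Vec.map ((ℕ→ℚ t ℚ.*_) ∘ (ℚ.1/ ℕ→ℚ t ℚ.*_)) y           ≡⟨ Vec.map-∘ (ℕ→ℚ t ℚ.*_) (ℚ.1/ ℕ→ℚ t ℚ.*_) y ⟩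
        Vec.map (ℕ→ℚ t ℚ.*_) x                                 ∎
        where y = Vec.map ℤ→ℚ (toℤ w)
    from : latticePoints (dilate t (Δ (suc (suc d)) k)) z → z ∈ map toℤ (points t d (k ℕ.* t))
    from (x , x∈Δ , z≡tx) with nonneg-vector z nonneg′
      where
      nonneg′ : ∀ i → 0ℚ ℚ.≤ ℤ→ℚ (lookup z i)
      nonneg′ i = subst₂ ℚ._≤_ (ℚ.*-zeroʳ (ℕ→ℚ t)) (begin
        ℕ→ℚ t ℚ.* lookup x i              ≡⟨ Vec.lookup-map i (ℕ→ℚ t ℚ.*_) x ⟨
        lookup (Vec.map (ℕ→ℚ t ℚ.*_) x) i ≡⟨ cong (λ v → lookup v i) z≡tx ⟨
        lookup (Vec.map ℤ→ℚ z) i          ≡⟨ Vec.lookup-map i ℤ→ℚ z ⟩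
        ℤ→ℚ (lookup z i)                  ∎)
        (ℚ.*-monoˡ-≤-nonNeg (ℕ→ℚ t) (Δ.nonneg x∈Δ i))
    ... | w , refl = ∈-map⁺ toℤ (points-complete t d (k ℕ.* t) w (Δ⇒InΔ d k x w z≡tx x∈Δ))

toℤ-injective : ∀ {n} {v w : Vec ℕ n} → toℤ v ≡ toℤ w → v ≡ w
toℤ-injective {v = []}    {[]}    _ = refl
toℤ-injective {v = x ∷ v} {y ∷ w} e =
  cong₂ _∷_ (ℤ.+-injective (Vec.∷-injectiveˡ e)) (toℤ-injective (Vec.∷-injectiveʳ e))

-- The Ehrhart polynomial

scaledPoly : ℕ → ℚ → (ℕ → ℕ) → Poly
scaledPoly M c a = applyUpTo (λ m → c ℚ.* ℕ→ℚ (a m)) (suc M)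

eval-scaledPoly : ∀ M c a t → eval (scaledPoly M c a) (ℕ→ℚ t) ≡ c ℚ.* ℕ→ℚ (hornerℕ M t a)
eval-scaledPoly zero c a t =
  trans (cong (c ℚ.* ℕ→ℚ (a 0) ℚ.+_) (ℚ.*-zeroʳ (ℕ→ℚ t))) (ℚ.+-identityʳ (c ℚ.* ℕ→ℚ (a 0)))
eval-scaledPoly (suc M) c a t = begin
  c ℚ.* ℕ→ℚ (a 0) ℚ.+ ℕ→ℚ t ℚ.* eval (scaledPoly M c (a ∘ suc)) (ℕ→ℚ t)
    ≡⟨ cong (λ x → c ℚ.* ℕ→ℚ (a 0) ℚ.+ ℕ→ℚ t ℚ.* x) (eval-scaledPoly M c (a ∘ suc) t) ⟩
  c ℚ.* ℕ→ℚ (a 0) ℚ.+ ℕ→ℚ t ℚ.* (c ℚ.* ℕ→ℚ H)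
    ≡⟨ lemma c (ℕ→ℚ (a 0)) (ℕ→ℚ t) (ℕ→ℚ H) ⟩
  c ℚ.* (ℕ→ℚ (a 0) ℚ.+ ℕ→ℚ t ℚ.* ℕ→ℚ H)
    ≡⟨ cong (λ x → c ℚ.* (ℕ→ℚ (a 0) ℚ.+ x)) (ℕ→ℚ-* t H) ⟨
  c ℚ.* (ℕ→ℚ (a 0) ℚ.+ ℕ→ℚ (t ℕ.* H))
    ≡⟨ cong (c ℚ.*_) (ℤ→ℚ-+ (+ a 0) (+ (t ℕ.* H))) ⟨
  c ℚ.* ℕ→ℚ (a 0 ℕ.+ t ℕ.* H) ∎
  where
  H = hornerℕ M t (a ∘ suc)
  lemma : ∀ c x t y → c ℚ.* x ℚ.+ t ℚ.* (c ℚ.* y) ≡ c ℚ.* (x ℚ.+ t ℚ.* y)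
  lemma = solve 4 (λ c x t y → c :* x :+ t :* (c :* y) := c :* (x :+ t :* y)) refl
    where open ℚ.+-*-Solver

coeff-scaledPoly : ∀ M b c a m → m ≤ M → coeff (b · scaledPoly M c a) m ≡ b ℚ.* (c ℚ.* ℕ→ℚ (a m))
coeff-scaledPoly M       b c a zero    _         = refl
coeff-scaledPoly (suc M) b c a (suc m) (s≤s m≤M) = coeff-scaledPoly M b c (a ∘ suc) m m≤M

theorem4p3 : ∀ (n k : ℕ) → 2 ≤ n → 1 ≤ k → k ≤ n ∸ 1 →
    ∃[ p ] IsEhrhartPolynomial (Δ n k) p ×
    (∀ m → (k ≤ n ∸ 2 × m ≤ n ∸ 1) ⊎ (k ≡ n ∸ 1 × m ≤ 1) →
    0ℚ < coeff (ℕ→ℚ ((n ∸ 1) !) · p) m)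
theorem4p3 (suc (suc d)) (suc k) (s≤s (s≤s z≤n)) (s≤s z≤n) _ = p , isEhrhart , positive-coeff
  where
  N : ℕ
  N = suc d !
  instance
    N-pos : ℚ.Positive (ℕ→ℚ N)
    N-pos = ℕ→ℚ-pos (ℕ.n≢0⇒n>0 (ℕ.≢-nonZero⁻¹ N {{ℕ._!≢0 (suc d)}}))
    N-nonZero : ℚ.NonZero (ℕ→ℚ N)
    N-nonZero = ℚ.pos⇒nonZero (ℕ→ℚ N)

  a : ℕ → ℕ
  a = panhandleCoeff d (suc k)

  p : Poly
  p = scaledPoly (suc d) (ℚ.1/ ℕ→ℚ N) a

  isEhrhart : IsEhrhartPolynomial (Δ (suc (suc d)) (suc k)) p
  isEhrhart (suc s) _ = length pts
    , (map toℤ pts , Unique.map⁺ toℤ-injective (points-unique t d (suc k ℕ.* t))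
      , latticePoints⇔points s d (suc k) , List.length-map toℤ pts)
    -- Multiplying by N = (n - 1)! clears the denominators of p and leaves the integer identity
    -- `panhandle-expansion`.
    , *-cancelˡ-≡-pos (ℕ→ℚ N) (begin
        ℕ→ℚ N ℚ.* eval p (ℕ→ℚ t)
          ≡⟨ cong (ℕ→ℚ N ℚ.*_) (eval-scaledPoly (suc d) (ℚ.1/ ℕ→ℚ N) a t) ⟩
        ℕ→ℚ N ℚ.* (ℚ.1/ ℕ→ℚ N ℚ.* ℕ→ℚ (hornerℕ (suc d) t a))
          ≡⟨ *-1/-cancel (ℕ→ℚ N) (ℕ→ℚ (hornerℕ (suc d) t a)) ⟩
        ℕ→ℚ (hornerℕ (suc d) t a)
          ≡⟨ cong ℤ→ℚ (panhandle-expansion s d k) ⟨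
        ℤ→ℚ (+ N ℤ.* panhandle t d (suc k ℕ.* t))
          ≡⟨ cong (λ x → ℤ→ℚ (+ N ℤ.* x)) (points-length t d (suc k ℕ.* t)) ⟨
        ℤ→ℚ (+ N ℤ.* + length pts)
          ≡⟨ ℤ→ℚ-* (+ N) (+ length pts) ⟩
        ℕ→ℚ N ℚ.* ℕ→ℚ (length pts) ∎)
    where
    t : ℕ
    t = suc s
    pts : List (Vec ℕ (suc (suc d)))
    pts = points t d (suc k ℕ.* t)

  positive-coeff : ∀ m → (suc k ≤ d × m ≤ suc d) ⊎ (suc k ≡ suc d × m ≤ 1) → 0ℚ < coeff (ℕ→ℚ N · p) m
  positive-coeff m c = subst (0ℚ <_) (sym (coeff-scaledPoly (suc d) (ℕ→ℚ N) (ℚ.1/ ℕ→ℚ N) a m (m≤ c)))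
    (ℚ.positive⁻¹ _ {{ℚ.pos*pos⇒pos (ℕ→ℚ N) _ {{ℚ.pos*pos⇒pos (ℚ.1/ ℕ→ℚ N) {{ℚ.1/pos⇒pos (ℕ→ℚ N)}}
      (ℕ→ℚ (a m)) {{ℕ→ℚ-pos (panhandleCoeff-pos d k m c)}}}}}})
    where
    m≤ : (suc k ≤ d × m ≤ suc d) ⊎ (suc k ≡ suc d × m ≤ 1) → m ≤ suc d
    m≤ (inj₁ (_ , m≤)) = m≤
    m≤ (inj₂ (_ , m≤1)) = ℕ.≤-trans m≤1 (s≤s z≤n)
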